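{- Let $\mathcal B_{\mathcal S}$ be the set of partitions $\beta_1+\cdots+\beta_n$ ($0<\beta_1\le\cdots\le\beta_n$) with $\beta_1\in\{1,2,3\}$ and, for each $2\le i\le n$: if $3\nmid\beta_i$ then $3\le\beta_i-\beta_{i-1}\le5$, and if $3\mid\beta_i$ then $4\le\beta_i-\beta_{i-1}\le6$. For a partition $\beta$ let $w(\beta)=u^{a(\beta)}v^{c(\beta)}q^{|\beta|}$, where $a(\beta)$ is the number of parts congruent to $0$ or $1$ mod $3$ and $c(\beta)$ is the number of parts congruent to $0$ or $2$ mod $3$. Let $b_{\mathcal S}(n)=\sum w(\beta)$ over $\beta\in\mathcal B_{\mathcal S}$ with exactly $n$ parts ($b_{\mathcal S}(0)=1$). Then, as formal power series in $q$ with coefficients polynomials in $u,v$, $$\sum_{n\ge0}\frac{b_{\mathcal S}(n)}{(q^3;q^3)_n}=(-uq;q^3)_\infty(-vq^2;q^3)_\infty=\prod_{j\ge1}(1+uq^{3j-2})(1+vq^{3j-1}).$$ Equivalently, the sum of $w(\pi)$ over all partitions $\pi$ whose consecutive parts differ by at least $3$, with difference at least $4$ whenever one of the two parts is divisible by $3$, equals $\prod_{j\ge1}(1+uq^{3j-2})(1+vq^{3j-1})$.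
   Context: $(a;q)_n=\prod_{j=0}^{n-1}(1-aq^j)$, $(a;q)_\infty=\prod_{j\ge0}(1-aq^j)$, $|\beta|$ is the sum of the parts. -}

module Defs where

open import Algebra.Bundles using (CommutativeRing)
import Algebra.Properties.Ring as RingProperties
import Algebra.Properties.Semiring.Exp as SemiringExp
import Algebra.Properties.Semiring.Sum as SemiringSum
import Algebra.Properties.CommutativeMonoid.Sum as MonoidSum
open import Data.Fin.Base as Fin using (Fin; toℕ)
open import Data.Integer.Properties using (+-*-commutativeRing)
open import Data.List.Base as List
  using (List; []; _∷_; length; filter; foldr; map; head; upTo; cartesianProductWith)
open import Data.List.Membership.Propositional using (_∈_)
open import Data.List.Membership.DecPropositional using (_∈?_)
open import Data.List.Membership.Propositional.Properties
  using (∈-cartesianProductWith⁺; ∈-cartesianProductWith⁻; ∈-filter⁺; ∈-filter⁻; ∈-upTo⁺)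
open import Data.List.Properties using (∷-injective)
open import Data.List.Relation.Binary.Subset.Propositional using (_⊆_)
open import Data.List.Relation.Unary.All as All using (All; []; _∷_)
open import Data.List.Relation.Unary.Any using (here; there)
open import Data.List.Relation.Unary.Linked as Linked using (Linked; []; [-]; _∷_; linked?)
open import Data.List.Relation.Unary.Unique.Propositional using (Unique; []; _∷_)
import Data.List.Relation.Unary.Unique.Propositional.Properties as Uniqueₚ
open import Data.Maybe.Relation.Unary.All as Maybe using (just; nothing)
open import Data.Nat.Base as ℕ using (ℕ; zero; suc; z≤n; s≤s)
open import Data.Nat.Divisibility using (_∣_; _∣?_)
open import Data.Nat.DivMod using (_%_)
import Data.Nat.ListAction as ℕ
import Data.Nat.Properties as ℕ
open import Data.Product using (Σ; ∃-syntax; _×_; _,_; proj₁; proj₂)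
open import Data.Sum.Base using (_⊎_; inj₁; inj₂)
open import Function.Base using (_∘_; _on_)
open import Function.Bundles using (_⇔_; mk⇔)
open import Level using (Level; _⊔_)
open import Relation.Binary.Core using (Rel)
open import Relation.Binary.PropositionalEquality as ≡ using (_≡_; refl)
import Relation.Binary.Reasoning.Setoid as SetoidReasoning
open import Relation.Nullary using (¬_; Dec; yes; no; ¬?; contradiction)
open import Relation.Nullary.Decidable using (_×-dec_; _⊎-dec_; _→-dec_)
open import Relation.Unary using (Pred; Decidable)

private
  variable
    a c ℓ p : Level

-- A duplicate-free list of exactly the elements satisfying P.
Enumeration : {A : Set a} → Pred A p → Set (a ⊔ p)
Enumeration P = ∃[ xs ] Unique xs × (∀ x → x ∈ xs ⇔ P x)

-- Formal power series over a commutative ring, as coefficient sequences.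
module PowerSeries (R : CommutativeRing c ℓ) where

  private
    module R where
      open CommutativeRing R public
      open SemiringSum semiring public
      open RingProperties ring public
      open SetoidReasoning setoid public
  open R using (_≈_)

  Series : Set c
  Series = ℕ → R.Carrier

  infix  4 _≋_
  infixl 7 _⊛_
  infixl 6 _⊕_

  _≋_ : Rel Series ℓ
  f ≋ g = ∀ n → f n ≈ g n

  _⊕_ _⊛_ : Series → Series → Series
  (f ⊕ g) n = f n R.+ g n
  (f ⊛ g) n = R.sum {suc n} λ i → f (toℕ i) R.* g (n ℕ.∸ toℕ i)

  ⊖_ : Series → Series
  (⊖ f) n = R.- f n

  const : R.Carrier → Series
  const x zero    = x
  const x (suc n) = R.0#

  X : Series
  X zero          = R.0#
  X (suc zero)    = R.1#
  X (suc (suc n)) = R.0#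

  sum-zero : ∀ {n} (t : Fin n → R.Carrier) → (∀ i → t i ≈ R.0#) → R.sum t ≈ R.0#
  sum-zero {n} t t≈0 = R.trans (R.sum-cong-≋ t≈0) (R.sum-replicate-zero n)

  private
    tail : Series → Series
    tail f = f ∘ suc

  ⊛-cong : ∀ {f f′ g g′} → f ≋ f′ → g ≋ g′ → f ⊛ g ≋ f′ ⊛ g′
  ⊛-cong p q n = R.sum-cong-≋ {suc n} λ i → R.*-cong (p (toℕ i)) (q (n ℕ.∸ toℕ i))

  ⊛-distribʳ : ∀ h f g → (f ⊕ g) ⊛ h ≋ (f ⊛ h) ⊕ (g ⊛ h)
  ⊛-distribʳ h f g n = R.trans
    (R.sum-cong-≋ {suc n} λ i → R.distribʳ (h (n ℕ.∸ toℕ i)) (f (toℕ i)) (g (toℕ i)))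
    (R.∑-distrib-+ {suc n} (λ i → f (toℕ i) R.* h (n ℕ.∸ toℕ i))
                           (λ i → g (toℕ i) R.* h (n ℕ.∸ toℕ i)))

  ⊛-scale : ∀ x f g n → ((λ m → x R.* f m) ⊛ g) n ≈ x R.* (f ⊛ g) n
  ⊛-scale x f g n = R.trans
    (R.sum-cong-≋ {suc n} λ i → R.*-assoc x (f (toℕ i)) (g (n ℕ.∸ toℕ i)))
    (R.sym (R.*-distribˡ-sum {suc n} x (λ i → f (toℕ i) R.* g (n ℕ.∸ toℕ i))))

  ⊛-last : ∀ f g n → (f ⊛ g) (suc n) ≈ (f ⊛ tail g) n R.+ f (suc n) R.* g 0
  ⊛-last f g zero = R.begin
    f 0 R.* g 1 R.+ (f 1 R.* g 0 R.+ R.0#)   R.≈⟨ R.+-assoc _ _ _ ⟨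
    (f 0 R.* g 1 R.+ f 1 R.* g 0) R.+ R.0#   R.≈⟨ R.+-identityʳ _ ⟩
    f 0 R.* g 1 R.+ f 1 R.* g 0              R.≈⟨ R.+-congʳ (R.+-identityʳ _) ⟨
    (f 0 R.* g 1 R.+ R.0#) R.+ f 1 R.* g 0   R.∎
  ⊛-last f g (suc n) = R.begin
    f 0 R.* g (2 ℕ.+ n) R.+ (tail f ⊛ g) (suc n)
      R.≈⟨ R.+-congˡ (⊛-last (tail f) g n) ⟩
    f 0 R.* g (2 ℕ.+ n) R.+ ((tail f ⊛ tail g) n R.+ f (2 ℕ.+ n) R.* g 0)
      R.≈⟨ R.+-assoc _ _ _ ⟨
    (f ⊛ tail g) (suc n) R.+ f (2 ℕ.+ n) R.* g 0  R.∎

  ⊛-comm : ∀ f g → f ⊛ g ≋ g ⊛ f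
  ⊛-comm f g zero    = R.+-congʳ (R.*-comm (f 0) (g 0))
  ⊛-comm f g (suc n) = R.begin
    f 0 R.* g (suc n) R.+ (tail f ⊛ g) n   R.≈⟨ R.+-comm _ _ ⟩
    (tail f ⊛ g) n R.+ f 0 R.* g (suc n)   R.≈⟨ R.+-cong (⊛-comm (tail f) g n) (R.*-comm _ _) ⟩
    (g ⊛ tail f) n R.+ g (suc n) R.* f 0   R.≈⟨ ⊛-last g f n ⟨
    (g ⊛ f) (suc n)                        R.∎

  ⊛-assoc : ∀ f g h → (f ⊛ g) ⊛ h ≋ f ⊛ (g ⊛ h)
  ⊛-assoc f g h zero = R.+-congʳ (R.begin
    (f 0 R.* g 0 R.+ R.0#) R.* h 0    R.≈⟨ R.*-congʳ (R.+-identityʳ _) ⟩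
    f 0 R.* g 0 R.* h 0               R.≈⟨ R.*-assoc _ _ _ ⟩
    f 0 R.* (g 0 R.* h 0)             R.≈⟨ R.*-congˡ (R.+-identityʳ _) ⟨
    f 0 R.* (g 0 R.* h 0 R.+ R.0#)    R.∎)
  ⊛-assoc f g h (suc n) = R.begin
    (f 0 R.* g 0 R.+ R.0#) R.* h (suc n) R.+ (((λ m → f 0 R.* g (suc m)) ⊕ (tail f ⊛ g)) ⊛ h) n
      R.≈⟨ R.+-cong (R.trans (R.*-congʳ (R.+-identityʳ _)) (R.*-assoc _ _ _))
                    (⊛-distribʳ h (λ m → f 0 R.* g (suc m)) (tail f ⊛ g) n) ⟩
    f 0 R.* (g 0 R.* h (suc n)) R.+
      (((λ m → f 0 R.* g (suc m)) ⊛ h) n R.+ ((tail f ⊛ g) ⊛ h) n)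
      R.≈⟨ R.+-congˡ (R.+-cong (⊛-scale (f 0) (tail g) h n) (⊛-assoc (tail f) g h n)) ⟩
    f 0 R.* (g 0 R.* h (suc n)) R.+ (f 0 R.* (tail g ⊛ h) n R.+ (tail f ⊛ (g ⊛ h)) n)
      R.≈⟨ R.+-assoc _ _ _ ⟨
    f 0 R.* (g 0 R.* h (suc n)) R.+ f 0 R.* (tail g ⊛ h) n R.+ (tail f ⊛ (g ⊛ h)) n
      R.≈⟨ R.+-congʳ (R.distribˡ _ _ _) ⟨
    f 0 R.* (g ⊛ h) (suc n) R.+ (tail f ⊛ (g ⊛ h)) n  R.∎

  ⊛-identityˡ : ∀ f → const R.1# ⊛ f ≋ f
  ⊛-identityˡ f n = R.begin
    (const R.1# ⊛ f) n  R.≈⟨ R.+-cong (R.*-identityˡ (f n))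
                               (sum-zero {n} _ λ i → R.zeroˡ (f (n ℕ.∸ suc (toℕ i)))) ⟩
    f n R.+ R.0#        R.≈⟨ R.+-identityʳ (f n) ⟩
    f n                 R.∎

  commutativeRing : CommutativeRing c ℓ
  commutativeRing = record
    { Carrier = Series ; _≈_ = _≋_ ; _+_ = _⊕_ ; _*_ = _⊛_ ; -_ = ⊖_
    ; 0# = λ _ → R.0# ; 1# = const R.1#
    ; isCommutativeRing = record
      { isRing = record
        { +-isAbelianGroup = record
          { isGroup = record
            { isMonoid = record
              { isSemigroup = record
                { isMagma = record
                  { isEquivalence = record
                    { refl  = λ _ → R.refl
                    ; sym   = λ p n → R.sym (p n)
                    ; trans = λ p q n → R.trans (p n) (q n) }
                  ; ∙-cong = λ p q n → R.+-cong (p n) (q n) }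
                ; assoc = λ f g h n → R.+-assoc (f n) (g n) (h n) }
              ; identity = (λ f n → R.+-identityˡ (f n)) , (λ f n → R.+-identityʳ (f n)) }
            ; inverse = (λ f n → R.-‿inverseˡ (f n)) , (λ f n → R.-‿inverseʳ (f n))
            ; ⁻¹-cong = λ p n → R.-‿cong (p n) }
          ; comm = λ f g n → R.+-comm (f n) (g n) }
        ; *-cong = ⊛-cong
        ; *-assoc = ⊛-assoc
        ; *-identity = ⊛-identityˡ ,
            λ f n → R.trans (⊛-comm f (const R.1#) n) (⊛-identityˡ f n)
        ; distrib =
            (λ f g h n → R.trans (⊛-comm f (g ⊕ h) n) (R.trans (⊛-distribʳ f g h n)
               (R.+-cong (⊛-comm g f n) (⊛-comm h f n))))
          , ⊛-distribʳ }
      ; *-comm = ⊛-comm } }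

  private
    module S where
      open CommutativeRing commutativeRing public
      open SemiringExp semiring public using (_^_)
      open MonoidSum *-commutativeMonoid public using () renaming (sum to product)
      open RingProperties ring public
      open SetoidReasoning setoid public

  -- Convergence: every coefficient is eventually constant.
  infix 4 _⟶_

  _⟶_ : (ℕ → Series) → Series → Set ℓ
  s ⟶ f = ∀ k → ∃[ N ] (∀ n → N ℕ.≤ n → s n k ≈ f k)

  sumList : {A : Set a} → (A → Series) → List A → Series
  sumList w xs = foldr S._+_ S.0# (map w xs)

  ∑⟨_⟩_ : {A : Set a} {P : Pred A p} → Enumeration P → (A → Series) → Series
  ∑⟨ xs , _ ⟩ w = sumList w xs

  -- Unordered sum of w over the (possibly infinite) set P: each coefficient
  -- is constant on all sufficiently large finite subsets of P.
  HasSum : {A : Set a} → Pred A p → (A → Series) → Series → Set (a ⊔ p ⊔ ℓ)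
  HasSum P w f = ∀ k → ∃[ xs ] All P xs ×
    (∀ ys → Unique ys → All P ys → xs ⊆ ys → sumList w ys k ≈ f k)

  -- The partial sums 1 + g + ⋯ + gⁿ⁻¹ in Horner form.
  geometric : Series → ℕ → Series
  geometric g zero    = S.0#
  geometric g (suc n) = S.1# S.+ g S.* geometric g n

  -- 1/f = ∑ₖ (1 - f)ᵏ; only meaningful when f has constant term 1.
  infix 9 _⁻¹
  _⁻¹ : Series → Series
  (f ⁻¹) n = geometric (S.1# S.- f) (suc n) n

  private
    ⊛-cong-below : ∀ {g h h′} n → g 0 ≈ R.0# → (∀ j → j ℕ.< n → h j ≈ h′ j) →
                   (g ⊛ h) n ≈ (g ⊛ h′) n
    ⊛-cong-below {g} n g₀ eq = R.+-cong
      (R.trans (R.trans (R.*-congʳ g₀) (R.zeroˡ _)) (R.sym (R.trans (R.*-congʳ g₀) (R.zeroˡ _))))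
      (R.sum-cong-≋ {n} λ i → R.*-congˡ {g (suc (toℕ i))} (eq _ (below i)))
      where
      below : ∀ {n} (i : Fin n) → n ℕ.∸ suc (toℕ i) ℕ.< n
      below {suc n} i = s≤s (ℕ.m∸n≤m n (toℕ i))

    geometric-step : ∀ {g} → g 0 ≈ R.0# → ∀ n j → j ℕ.< n →
                     geometric g (suc n) j ≈ geometric g n j
    geometric-step {g} g₀ (suc n) j (s≤s j≤n) = R.+-congˡ
      (⊛-cong-below {g} {geometric g (suc n)} {geometric g n} j g₀
        λ i i<j → geometric-step g₀ n i (ℕ.<-≤-trans i<j j≤n))

    geometric-stable : ∀ {g} → g 0 ≈ R.0# → ∀ n j → j ℕ.< n →
                       geometric g n j ≈ geometric g (suc j) j
    geometric-stable g₀ (suc n) j (s≤s j≤n) with ℕ.m≤n⇒m<n∨m≡n j≤n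
    ... | inj₁ j<n  = R.trans (geometric-step g₀ n j j<n) (geometric-stable g₀ n j j<n)
    ... | inj₂ refl = R.refl

  ⁻¹-inverseʳ : ∀ f → f 0 ≈ R.1# → f S.* f ⁻¹ S.≈ S.1#
  ⁻¹-inverseʳ f f₀ = S.begin
    f S.* h                            S.≈⟨ S.*-congʳ (S.-‿involutive f) ⟨
    S.- (S.- f) S.* h                  S.≈⟨ S.-‿distribˡ-* (S.- f) h ⟨
    S.- (S.- f S.* h)                  S.≈⟨ S.+-identityˡ _ ⟨
    S.0# S.- S.- f S.* h               S.≈⟨ S.+-congʳ (S.-‿inverseʳ h) ⟨
    (h S.- h) S.- S.- f S.* h          S.≈⟨ S.+-assoc h (S.- h) (S.- (S.- f S.* h)) ⟩
    h S.+ (S.- h S.- S.- f S.* h)      S.≈⟨ S.+-congˡ (S.-‿+-comm h (S.- f S.* h)) ⟩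
    h S.- (h S.+ S.- f S.* h)          S.≈⟨ S.+-congˡ (S.-‿cong (S.+-congʳ (S.*-identityˡ h))) ⟨
    h S.- (S.1# S.* h S.+ S.- f S.* h) S.≈⟨ S.+-congˡ (S.-‿cong (S.distribʳ h S.1# (S.- f))) ⟨
    h S.- g S.* h                      S.≈⟨ S.+-congʳ fixpoint ⟩
    (S.1# S.+ g S.* h) S.- g S.* h     S.≈⟨ S.+-assoc S.1# (g S.* h) (S.- (g S.* h)) ⟩
    S.1# S.+ (g S.* h S.- g S.* h)     S.≈⟨ S.+-congˡ (S.-‿inverseʳ (g S.* h)) ⟩
    S.1# S.+ S.0#                      S.≈⟨ S.+-identityʳ S.1# ⟩
    S.1#                               S.∎
    where
    g = S.1# S.- f
    h = f ⁻¹
    g₀ : g 0 ≈ R.0#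
    g₀ = R.trans (R.+-congˡ (R.-‿cong f₀)) (R.-‿inverseʳ R.1#)
    fixpoint : h S.≈ S.1# S.+ g S.* h
    fixpoint n = R.+-congˡ (⊛-cong-below {g} {geometric g n} {h} n g₀ (geometric-stable g₀ n))

  pochhammer : Series → Series → ℕ → Series
  pochhammer a p n = S.product {n} λ j → S.1# S.- a S.* p S.^ toℕ j

  private
    product-constantTerm : ∀ {n} (t : Fin n → Series) → (∀ i → t i 0 ≈ R.1#) →
                           S.product t 0 ≈ R.1#
    product-constantTerm {zero}  t t₀ = R.refl
    product-constantTerm {suc n} t t₀ = R.begin
      t Fin.zero 0 R.* S.product (t ∘ Fin.suc) 0 R.+ R.0#  R.≈⟨ R.+-identityʳ _ ⟩
      t Fin.zero 0 R.* S.product (t ∘ Fin.suc) 0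
        R.≈⟨ R.*-cong (t₀ Fin.zero) (product-constantTerm (t ∘ Fin.suc) (t₀ ∘ Fin.suc)) ⟩
      R.1# R.* R.1#                                        R.≈⟨ R.*-identityˡ R.1# ⟩
      R.1#                                                 R.∎

  pochhammer-constantTerm : ∀ a p n → a 0 ≈ R.0# → pochhammer a p n 0 ≈ R.1#
  pochhammer-constantTerm a p n a₀ = product-constantTerm {n} _ λ j → R.begin
    R.1# R.- (a 0 R.* (p S.^ toℕ j) 0 R.+ R.0#)
      R.≈⟨ R.+-congˡ (R.-‿cong (R.trans (R.+-identityʳ _) (R.trans (R.*-congʳ a₀) (R.zeroˡ _)))) ⟩
    R.1# R.- R.0#  R.≈⟨ R.+-congˡ R.-0#≈0# ⟩
    R.1# R.+ R.0#  R.≈⟨ R.+-identityʳ R.1# ⟩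
    R.1#           R.∎

  -- In particular the reciprocal of (q³;q³)ₙ is a genuine one.
  pochhammer-inverseʳ : ∀ m p n → let f = pochhammer (X S.^ suc m) p n in
                        f S.* f ⁻¹ S.≈ S.1#
  pochhammer-inverseʳ m p n = ⁻¹-inverseʳ (pochhammer (X S.^ suc m) p n)
    (pochhammer-constantTerm (X S.^ suc m) p n
      (R.trans (R.+-identityʳ _) (R.zeroˡ ((X S.^ m) 0))))

-- Polynomials are the power series whose coefficients eventually vanish.
module Polynomial (R : CommutativeRing c ℓ) where

  private
    module R = CommutativeRing R
    module P = PowerSeries R
    module S = CommutativeRing P.commutativeRing
  open R using (_≈_)

  Bounded : P.Series → Set ℓ
  Bounded f = ∃[ N ] (∀ n → N ℕ.≤ n → f n ≈ R.0#)

  Poly : Set (c ⊔ ℓ)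
  Poly = Σ P.Series Bounded

  const : R.Carrier → Poly
  const x = P.const x , 1 , λ { (suc n) _ → R.refl }

  X : Poly
  X = P.X , 2 , λ { (suc zero) (s≤s ()) ; (suc (suc n)) _ → R.refl }

  private
    ⊕-bounded : ∀ {f g} → Bounded f → Bounded g → Bounded (f P.⊕ g)
    ⊕-bounded (N , p) (M , q) = N ℕ.⊔ M , λ n le → R.trans
      (R.+-cong (p n (ℕ.m⊔n≤o⇒m≤o N M le)) (q n (ℕ.m⊔n≤o⇒n≤o N M le))) (R.+-identityˡ R.0#)

    ⊖-bounded : ∀ {f} → Bounded f → Bounded (P.⊖ f)
    ⊖-bounded (N , p) = N , λ n le → R.trans (R.-‿cong (p n le))
      (RingProperties.-0#≈0# R.ring)

    ⊛-bounded : ∀ {f g} → Bounded f → Bounded g → Bounded (f P.⊛ g)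
    ⊛-bounded {f} {g} (N , p) (M , q) = N ℕ.+ M , λ n le → P.sum-zero {suc n} _ λ i → term n le (toℕ i)
      where
      term : ∀ n → N ℕ.+ M ℕ.≤ n → ∀ i → f i R.* g (n ℕ.∸ i) ≈ R.0#
      term n le i with N ℕ.≤? i
      ... | yes N≤i = R.trans (R.*-congʳ (p i N≤i)) (R.zeroˡ _)
      ... | no  N≰i = R.trans (R.*-congˡ (q (n ℕ.∸ i) (ℕ.m+n≤o⇒m≤o∸n M
        (ℕ.≤-trans (ℕ.≤-reflexive (ℕ.+-comm M i))
          (ℕ.≤-trans (ℕ.+-monoˡ-≤ M (ℕ.<⇒≤ (ℕ.≰⇒> N≰i))) le))))) (R.zeroʳ _)

  commutativeRing : CommutativeRing (c ⊔ ℓ) ℓ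
  commutativeRing = record
    { Carrier = Poly ; _≈_ = P._≋_ on proj₁
    ; _+_ = λ { (f , p) (g , q) → f P.⊕ g , ⊕-bounded p q }
    ; _*_ = λ { (f , p) (g , q) → f P.⊛ g , ⊛-bounded p q }
    ; -_  = λ { (f , p) → P.⊖ f , ⊖-bounded p }
    ; 0#  = (λ _ → R.0#) , 0 , λ _ _ → R.refl
    ; 1#  = const R.1#
    ; isCommutativeRing = record
      { isRing = record
        { +-isAbelianGroup = record
          { isGroup = record
            { isMonoid = record
              { isSemigroup = record
                { isMagma = record
                  { isEquivalence = record
                    { refl  = λ _ → R.refl
                    ; sym   = λ p n → R.sym (p n)
                    ; trans = λ p q n → R.trans (p n) (q n) }
                  ; ∙-cong = λ p q n → R.+-cong (p n) (q n) }
                ; assoc = λ (f , _) (g , _) (h , _) → S.+-assoc f g h }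
              ; identity = (λ (f , _) → S.+-identityˡ f) , (λ (f , _) → S.+-identityʳ f) }
            ; inverse = (λ (f , _) → S.-‿inverseˡ f) , (λ (f , _) → S.-‿inverseʳ f)
            ; ⁻¹-cong = λ p n → R.-‿cong (p n) }
          ; comm = λ (f , _) (g , _) → S.+-comm f g }
        ; *-cong = λ p q → S.*-cong p q
        ; *-assoc = λ (f , _) (g , _) (h , _) → S.*-assoc f g h
        ; *-identity = (λ (f , _) → S.*-identityˡ f) , (λ (f , _) → S.*-identityʳ f)
        ; distrib = (λ (f , _) (g , _) (h , _) → S.distribˡ f g h)
                  , (λ (f , _) (g , _) (h , _) → S.distribʳ f g h) }
      ; *-comm = λ (f , _) (g , _) → S.*-comm f g } }

-- Partitions, listed with parts in weakly increasing order.
IsPartition : Pred (List ℕ) _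
IsPartition β = All (0 ℕ.<_) β × Linked ℕ._≤_ β

size : List ℕ → ℕ
size = ℕ.sum

count≡ : ℕ → ℕ → List ℕ → ℕ
count≡ r s β = length (filter (λ b → (b % 3 ℕ.≟ r) ⊎-dec (b % 3 ℕ.≟ s)) β)

-- In the two relations below x ≤ y whenever they are used, so that y ∸ x is
-- the true difference.
𝓑Gap : Rel ℕ _
𝓑Gap x y =
  (¬ 3 ∣ y → 3 ℕ.≤ y ℕ.∸ x × y ℕ.∸ x ℕ.≤ 5) ×
  (3 ∣ y → 4 ℕ.≤ y ℕ.∸ x × y ℕ.∸ x ℕ.≤ 6)

SchurGap : Rel ℕ _
SchurGap x y = 3 ℕ.≤ y ℕ.∸ x × (3 ∣ x ⊎ 3 ∣ y → 4 ℕ.≤ y ℕ.∸ x)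

-- The empty partition belongs to both sets.
𝓑 : Pred (List ℕ) _
𝓑 β = IsPartition β × Maybe.All (_∈ 1 ∷ 2 ∷ 3 ∷ []) (head β) × Linked 𝓑Gap β

Schur : Pred (List ℕ) _
Schur π = IsPartition π × Linked SchurGap π

𝓑OfLength : ℕ → Pred (List ℕ) _
𝓑OfLength n β = 𝓑 β × length β ≡ n

private
  𝓑Gap? : ∀ x y → Dec (𝓑Gap x y)
  𝓑Gap? x y =
    (¬? (3 ∣? y) →-dec (3 ℕ.≤? y ℕ.∸ x ×-dec y ℕ.∸ x ℕ.≤? 5)) ×-dec
    (3 ∣? y →-dec (4 ℕ.≤? y ℕ.∸ x ×-dec y ℕ.∸ x ℕ.≤? 6))

  𝓑? : Decidable 𝓑
  𝓑? β = (All.all? (0 ℕ.<?_) β ×-dec linked? ℕ._≤?_ β) ×-dec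
    Maybe.dec (λ b → _∈?_ ℕ._≟_ b (1 ∷ 2 ∷ 3 ∷ [])) (head β) ×-dec linked? 𝓑Gap? β

  words : ℕ → ℕ → List (List ℕ)
  words N zero    = [] ∷ []
  words N (suc n) = cartesianProductWith _∷_ (upTo N) (words N n)

  words-unique : ∀ N n → Unique (words N n)
  words-unique N zero    = [] ∷ []
  words-unique N (suc n) =
    Uniqueₚ.cartesianProductWith⁺ _∷_ ∷-injective (Uniqueₚ.upTo⁺ N) (words-unique N n)

  ∈-words⁺ : ∀ {N} {xs} → All (ℕ._< N) xs → xs ∈ words N (length xs)
  ∈-words⁺ []         = here refl
  ∈-words⁺ (x<N ∷ ps) = ∈-cartesianProductWith⁺ _∷_ (∈-upTo⁺ x<N) (∈-words⁺ ps)

  ∈-words⁻ : ∀ N n {xs} → xs ∈ words N n → length xs ≡ n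
  ∈-words⁻ N zero    (here refl) = refl
  ∈-words⁻ N (suc n) xs∈ with ∈-cartesianProductWith⁻ _∷_ (upTo N) (words N n) xs∈
  ... | _ , _ , _ , ys∈ , refl = ≡.cong suc (∈-words⁻ N n ys∈)

  𝓑Gap⇒≤ : ∀ {x y} → 𝓑Gap x y → y ℕ.≤ x ℕ.+ 6
  𝓑Gap⇒≤ {x} {y} (p , q) = ℕ.≤-trans (ℕ.m≤n+m∸n y x) (ℕ.+-monoʳ-≤ x gap≤6)
    where
    gap≤6 : y ℕ.∸ x ℕ.≤ 6
    gap≤6 with 3 ∣? y
    ... | yes 3∣y = proj₂ (q 3∣y)
    ... | no  3∤y = ℕ.≤-trans (proj₂ (p 3∤y)) (ℕ.n≤1+n 5)

  bounded : ∀ {N x xs} → x ℕ.< N → Linked 𝓑Gap (x ∷ xs) →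
            All (ℕ._< (length xs ℕ.* 6 ℕ.+ N)) (x ∷ xs)
  bounded x<N [-] = x<N ∷ []
  bounded {N} {x} {y ∷ ys} x<N (g ∷ gs) =
    ℕ.<-≤-trans x<N (ℕ.m≤n+m N _) ∷
    ≡.subst (λ M → All (ℕ._< M) (y ∷ ys)) eq (bounded y<N+6 gs)
    where
    y<N+6 : y ℕ.< N ℕ.+ 6
    y<N+6 = ℕ.≤-<-trans (𝓑Gap⇒≤ g) (ℕ.+-monoˡ-< 6 x<N)
    eq : length ys ℕ.* 6 ℕ.+ (N ℕ.+ 6) ≡ 6 ℕ.+ length ys ℕ.* 6 ℕ.+ N
    eq = ≡.trans (≡.cong (length ys ℕ.* 6 ℕ.+_) (ℕ.+-comm N 6))
        (≡.trans (≡.sym (ℕ.+-assoc (length ys ℕ.* 6) 6 N))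
                 (≡.cong (ℕ._+ N) (ℕ.+-comm (length ys ℕ.* 6) 6)))

  first<4 : ∀ {x} → x ∈ 1 ∷ 2 ∷ 3 ∷ [] → x ℕ.< 4
  first<4 (here refl)                 = s≤s (s≤s z≤n)
  first<4 (there (here refl))         = s≤s (s≤s (s≤s z≤n))
  first<4 (there (there (here refl))) = ℕ.≤-refl

  𝓑-bounded : ∀ {β} → 𝓑 β → All (ℕ._< (length β ℕ.* 6 ℕ.+ 4)) β
  𝓑-bounded {[]}    _                 = []
  𝓑-bounded {x ∷ β} (_ , just x∈ , l) = All.map
    (λ lt → ℕ.<-≤-trans lt (ℕ.+-monoˡ-≤ 4 (ℕ.m≤n+m (length β ℕ.* 6) 6)))
    (bounded (first<4 x∈) l)

𝓑-enumeration : ∀ n → Enumeration (𝓑OfLength n)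
𝓑-enumeration n = filter 𝓑? ws , Uniqueₚ.filter⁺ 𝓑? (words-unique N n) , λ β → mk⇔
  (λ β∈ → let β∈ws , b = ∈-filter⁻ 𝓑? β∈ in b , ∈-words⁻ N n β∈ws)
  (λ { (b , refl) → ∈-filter⁺ 𝓑? (∈-words⁺ (𝓑-bounded b)) b })
  where
  N  = n ℕ.* 6 ℕ.+ 4
  ws = words N n

module Generating (K : CommutativeRing c ℓ) (u₀ v₀ : CommutativeRing.Carrier K) where

  private
    module K⟦q⟧ = PowerSeries K
    module S = CommutativeRing K⟦q⟧.commutativeRing

  open K⟦q⟧ public using (Series; _⟶_; HasSum; ∑⟨_⟩_; _⁻¹; pochhammer)
  open S public using (_≈_; _+_; _*_; -_; 0#; 1#)
  open SemiringExp S.semiring public using (_^_)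
  open SemiringSum S.semiring public using (sum-syntax)

  product-syntax : ∀ n → (Fin n → Series) → Series
  product-syntax n = MonoidSum.sum S.*-commutativeMonoid

  infixl 10 product-syntax
  syntax product-syntax n (λ i → x) = ∏[ i < n ] x

  u v q : Series
  u = K⟦q⟧.const u₀
  v = K⟦q⟧.const v₀
  q = K⟦q⟧.X

  weight : List ℕ → Series
  weight β = u ^ count≡ 0 1 β * v ^ count≡ 0 2 β * q ^ size β

  b𝓢 : ℕ → Series
  b𝓢 n = ∑⟨ 𝓑-enumeration n ⟩ weight

  b𝓢-zero : b𝓢 0 ≈ 1#
  b𝓢-zero = S.trans (S.+-identityʳ (1# * 1# * 1#))
    (S.trans (S.*-identityʳ (1# * 1#)) (S.*-identityʳ 1#))

-- From here on K = ℤ[u,v] = ℤ[u][v].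
module ℤ[u]   = Polynomial +-*-commutativeRing
module ℤ[u,v] = Polynomial ℤ[u].commutativeRing

open Generating ℤ[u,v].commutativeRing (ℤ[u,v].const ℤ[u].X) ℤ[u,v].X public

{-# OPTIONS --safe #-}

-- Subtracting 3λ, where λ has at most n parts, turns a Schur partition with n parts
-- into a unique element β of 𝓑 with n parts and leaves all residues mod 3 unchanged.
-- Bounding the parts of λ by l multiplies b(n) by the Gaussian binomial coefficient
-- [n + l, n] in q³.  Removing the least part of β gives recurrences for b(n) that imply
-- the finite identity ∑ₙ [N, n] b(n) = ∏_{j < N} (1 + u q³ʲ⁺¹) (1 + v q³ʲ⁺²).  Since b(n)
-- is divisible by qⁿ and [N, n] agrees with 1 / (q³; q³)ₙ below qᴺ⁻ⁿ⁺¹, its N-th instance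
-- determines all coefficients up to qᴺ of the three expressions to be compared.

module Submission where

open import Defs using (module PowerSeries; module Generating; Enumeration; IsPartition; 𝓑;
  𝓑Gap; 𝓑OfLength; 𝓑-enumeration; Schur; SchurGap; count≡; size)
open import Algebra.Bundles using (CommutativeRing)
import Algebra.Properties.CommutativeMonoid.Sum as MonoidSum
import Algebra.Properties.Ring as RingProperties
import Algebra.Properties.Semiring.Exp as SemiringExp
import Algebra.Properties.Semiring.Sum as SemiringSum
import Algebra.Solver.Ring.NaturalCoefficients.Default as SemiringSolver
open import Data.Bool.Base using (true; false)
open import Data.Fin.Base using (Fin; toℕ)
import Data.Fin.Properties as Fin
open import Data.List.Base using (List; []; _∷_; _++_; map; foldr; length; head)
open import Data.List.Membership.Propositional using (_∈_)
open import Data.List.Membership.Propositional.Properties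
  using (∈-∃++; ∈-map⁺; ∈-map⁻; ∈-++⁺ˡ; ∈-++⁺ʳ)
open import Data.List.Properties using (∷-injectiveʳ)
open import Data.List.Relation.Binary.Permutation.Propositional as ↭ using (_↭_; ↭⇒↭ₛ; ↭-sym)
open import Data.List.Relation.Binary.Permutation.Propositional.Properties using (∈-resp-↭; shift)
import Data.List.Relation.Binary.Permutation.Setoid.Properties as Permutationₛ
open import Data.List.Relation.Binary.Subset.Propositional using (_⊆_)
open import Data.List.Relation.Unary.All as All using (All; []; _∷_)
import Data.List.Relation.Unary.All.Properties as Allₚ
open import Data.List.Relation.Unary.Any using (here; there)
open import Data.List.Relation.Unary.Linked using (Linked; []; [-]; _∷_)
open import Data.List.Relation.Unary.Unique.Propositional using (Unique; []; _∷_)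
import Data.List.Relation.Unary.Unique.Propositional.Properties as Uniqueₚ
open import Data.Maybe.Relation.Unary.All as Maybe using (just; nothing)
open import Data.Nat.Base as ℕ using (ℕ; zero; suc; z≤n; s≤s; _∸_)
open import Data.Nat.Divisibility using (_∣_; _∣?_; ∣m+n∣m⇒∣n; ∣m∣n⇒∣m+n; ∣-refl; _∣0)
open import Data.Nat.DivMod using (_%_)
import Data.Nat.Properties as ℕ
open import Data.Product using (_×_; _,_; proj₁; ∃-syntax)
open import Data.Sum.Base as Sum using (_⊎_; inj₁; inj₂; [_,_]′)
open import Function.Base using (_∘_)
open import Function.Bundles using (Equivalence)
open import Relation.Binary.PropositionalEquality as ≡ using (_≡_)
import Relation.Binary.Reasoning.Setoid as SetoidReasoning
open import Relation.Nullary using (¬_; does; yes; no; contradiction)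
open import Relation.Nullary.Decidable using (_⊎-dec_; from-no)

-- The recurrence for b(n) is not closed. After a part congruent to 2 mod 3 the next window begins
-- at residue 2, so a companion sequence h enters, summing over chains whose first window is {2, 3,
-- 4}. Write a = uq, b = vq², Q = q³ and F(N) = ∑ [N, n] b(n). The goal is the first-order
-- recurrence F(N + 1) = (1 + aQᴺ) (1 + bQᴺ) F(N), but Pascal's rule expresses F(N + 1) through
-- F(N), ∑ [N, n] h(n) and ∑ [N, n] Qⁿ b(n). Neither of the last two sums is evaluated by itself.
-- They occur only as the first plus a times the second, and this combination equals (1 + aQᴺ) F(N),
-- so h drops out. Working at finite N also serves the unordered sum over Schur partitions: F(N) is
-- the total weight of an explicit finite list of them, and these lists exhaust the set as N grows.

module QBinomial {c ℓ} (R : CommutativeRing c ℓ) (Q : CommutativeRing.Carrier R) where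

  -- Gaussian binomial coefficients and sums against them.

  open CommutativeRing R hiding (zero)
  open SemiringExp semiring using (_^_; ^-homo-*)
  open SemiringSum semiring using (sum-syntax)
  open RingProperties ring using (+-cancelʳ)
  open SemiringSolver commutativeSemiring using (solve; _:=_; _:+_; _:*_; con)
  open SetoidReasoning setoid

  -- G n l is the Gaussian binomial coefficient [n + l, n].
  G : ℕ → ℕ → Carrier
  G zero    _       = 1#
  G (suc n) zero    = 1#
  G (suc n) (suc l) = Q ^ suc n * G (suc n) l + G n (suc l)

  G-zeroʳ : ∀ n → G n 0 ≈ 1#
  G-zeroʳ zero    = refl
  G-zeroʳ (suc n) = refl

  -- In terms of partitions in a box of n + 1 rows and l + 1 columns, the defining rule asks whether
  -- there is a full column; this conjugate rule asks whether there is a full row.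
  G-pascal : ∀ n l → G (suc n) (suc l) ≈ G (suc n) l + Q ^ suc l * G n (suc l)
  G-pascal zero zero =
    solve 1 (λ q → q :* con 1 :* con 1 :+ con 1 := con 1 :+ q :* con 1 :* con 1) refl Q
  G-pascal zero (suc l) = begin
    Q ^ 1 * G 1 (suc l) + 1#                   ≈⟨ +-congʳ (*-congˡ (G-pascal zero l)) ⟩
    Q ^ 1 * (G 1 l + Q ^ suc l * 1#) + 1#
      ≈⟨ solve 3 (λ q g p → q :* con 1 :* (g :+ p :* con 1) :+ con 1 :=
           q :* con 1 :* g :+ con 1 :+ q :* p :* con 1) refl Q (G 1 l) (Q ^ suc l) ⟩
    Q ^ 1 * G 1 l + 1# + Q ^ suc (suc l) * 1#  ∎
  G-pascal (suc n) zero = begin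
    Q ^ suc (suc n) * 1# + G (suc n) 1
      ≈⟨ +-congˡ (trans (G-pascal n zero) (+-congʳ refl)) ⟩
    Q ^ suc (suc n) * 1# + (1# + Q ^ 1 * G n 1)
      ≈⟨ solve 3 (λ q p g → q :* p :* con 1 :+ (con 1 :+ q :* con 1 :* g) :=
           con 1 :+ q :* con 1 :* (p :* con 1 :+ g)) refl Q (Q ^ suc n) (G n 1) ⟩
    1# + Q ^ 1 * G (suc n) 1 ∎
  G-pascal (suc n) (suc l) = begin
    Q ^ suc (suc n) * G (suc (suc n)) (suc l) + G (suc n) (suc (suc l))
      ≈⟨ +-cong (*-congˡ (G-pascal (suc n) l)) (G-pascal n (suc l)) ⟩
    Q ^ suc (suc n) * (G (suc (suc n)) l + Q ^ suc l * G (suc n) (suc l)) +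
      (G (suc n) (suc l) + Q ^ suc (suc l) * G n (suc (suc l)))
      ≈⟨ solve 6 (λ q x y g h k →
           q :* x :* (g :+ y :* h) :+ (h :+ q :* y :* k) :=
           q :* x :* g :+ h :+ q :* y :* (x :* h :+ k)) refl
           Q (Q ^ suc n) (Q ^ suc l) (G (suc (suc n)) l) (G (suc n) (suc l)) (G n (suc (suc l))) ⟩
    G (suc (suc n)) (suc l) + Q ^ suc (suc l) * G (suc n) (suc (suc l)) ∎

  -- Equating the two Pascal rules gives `G (suc n) l * (1 - Q ^ suc n)` =
  -- `G n (suc l) * (1 - Q ^ suc l)`, kept free of subtraction for the semiring solver.
  G-absorption : ∀ n l → G (suc n) l + Q ^ suc l * G n (suc l) ≈
                         G n (suc l) + Q ^ suc n * G (suc n) l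
  G-absorption n l = trans (sym (G-pascal n l)) (+-comm _ _)

  -- The sum over n + l = N; carrying both indices avoids the truncated difference of N and n.
  antidiagonal : ℕ → (ℕ → ℕ → Carrier) → Carrier
  antidiagonal zero    t = t 0 0
  antidiagonal (suc N) t = t 0 (suc N) + antidiagonal N (λ n l → t (suc n) l)

  antidiagonal-cong : ∀ N {s t} → (∀ n l → n ℕ.+ l ≡ N → s n l ≈ t n l) →
                      antidiagonal N s ≈ antidiagonal N t
  antidiagonal-cong zero    s≈t = s≈t 0 0 ≡.refl
  antidiagonal-cong (suc N) s≈t =
    +-cong (s≈t 0 (suc N) ≡.refl)
           (antidiagonal-cong N λ n l eq → s≈t (suc n) l (≡.cong suc eq))

  antidiagonal-+ : ∀ N s t → antidiagonal N (λ n l → s n l + t n l) ≈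
                             antidiagonal N s + antidiagonal N t
  antidiagonal-+ zero    s t = refl
  antidiagonal-+ (suc N) s t = trans (+-congˡ (antidiagonal-+ N _ _))
    (solve 4 (λ a b c d → a :+ b :+ (c :+ d) := a :+ c :+ (b :+ d)) refl
      (s 0 (suc N)) (t 0 (suc N)) _ _)

  antidiagonal-* : ∀ N x t → antidiagonal N (λ n l → x * t n l) ≈ x * antidiagonal N t
  antidiagonal-* zero    x t = refl
  antidiagonal-* (suc N) x t = trans (+-congˡ (antidiagonal-* N x _)) (sym (distribˡ x _ _))

  antidiagonal-last : ∀ N t → antidiagonal (suc N) t ≈
                              antidiagonal N (λ n l → t n (suc l)) + t (suc N) 0
  antidiagonal-last zero    t = refl
  antidiagonal-last (suc N) t =
    trans (+-congˡ (antidiagonal-last N λ n l → t (suc n) l)) (sym (+-assoc _ _ _))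

  antidiagonal-const : ∀ N t → antidiagonal N (λ n _ → t n) ≈ ∑[ n < suc N ] t (toℕ n)
  antidiagonal-const zero    t = sym (+-identityʳ _)
  antidiagonal-const (suc N) t = +-congˡ (antidiagonal-const N (λ n → t (suc n)))

  binomialSum : ℕ → (ℕ → Carrier) → Carrier
  binomialSum N f = antidiagonal N λ n l → G n l * f n

  binomialSum-suc : ∀ N f → binomialSum (suc N) f ≈
    binomialSum N f + antidiagonal N (λ n l → Q ^ l * (G n l * f (suc n)))
  binomialSum-suc N f = begin
    1# * f 0 + antidiagonal N (λ n l → G (suc n) l * f (suc n))
      ≈⟨ +-cong refl (trans (antidiagonal-cong N λ n l _ → split n l) (antidiagonal-+ N _ _)) ⟩
    1# * f 0 + (antidiagonal N (λ n l → old (suc n) l) + new)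
      ≈⟨ +-assoc _ _ _ ⟨
    antidiagonal (suc N) old + new
      ≈⟨ +-congʳ (trans (antidiagonal-last N old) (+-identityʳ _)) ⟩
    binomialSum N f + new ∎
    where
    new = antidiagonal N (λ n l → Q ^ l * (G n l * f (suc n)))
    -- The value 0 is the convention that [N, N + 1] vanishes; it lets the Pascal splitting be
    -- uniform in `l`.
    old : ℕ → ℕ → Carrier
    old n zero    = 0#
    old n (suc l) = G n l * f n
    split : ∀ n l → G (suc n) l * f (suc n) ≈ old (suc n) l + Q ^ l * (G n l * f (suc n))
    split n zero    = trans
      (solve 1 (λ x → con 1 :* x := con 0 :+ con 1 :* (con 1 :* x)) refl (f (suc n)))
      (+-congˡ (*-congˡ (*-congʳ (sym (G-zeroʳ n)))))
    split n (suc l) = trans (*-congʳ (G-pascal n l))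
      (solve 4 (λ g p h x → (g :+ p :* h) :* x := g :* x :+ p :* (h :* x)) refl
        (G (suc n) l) (Q ^ suc l) (G n (suc l)) (f (suc n)))

  -- The product formula for two coupled sequences.

  module Product
    (a b : Carrier) (f h : ℕ → Carrier)
    (f-zero : f 0 ≈ 1#) (h-zero : h 0 ≈ 1#)
    (f-suc : ∀ n → f (suc n) ≈ Q ^ n * (a * f n + b * h n + a * b * (Q ^ n * f n)))
    (h-suc : ∀ n → h (suc n) ≈ Q ^ n * (b * h n + a * b * (Q ^ n * f n) + a * (Q ^ suc n * f n)))
    where

    private
      F : ℕ → Carrier
      F N = binomialSum N f

      f′ : ℕ → Carrier
      f′ n = Q ^ n * f n

    -- The recurrences give f (n + 1) - h (n + 1) = a Qⁿ (1 - Qⁿ⁺¹) f n, and absorption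
    -- turns [N, n + 1] (1 - Qⁿ⁺¹) into [N, n] (1 - Qᴺ⁻ⁿ).
    difference : ∀ n l →
      G (suc n) l * h (suc n) + a * (G n (suc l) * f′ n) ≈
      G (suc n) l * f (suc n) + a * (Q ^ suc l * (G n (suc l) * f′ n))
    -- In place of subtracting, two terms are added to both sides: the first completes `compare`,
    -- the second completes absorption.
    difference n l = +-cancelʳ (g * (a * f′ n) + g * (a * (Q ^ suc n * f′ n))) _ _ (begin
      g * h (suc n) + a * (g′ * f′ n) + (g * (a * f′ n) + g * (a * (Q ^ suc n * f′ n)))
        ≈⟨ solve 6 (λ g g′ h a f p →
             g :* h :+ a :* (g′ :* f) :+ (g :* (a :* f) :+ g :* (a :* (p :* f))) :=
             g :* (h :+ a :* f) :+ a :* f :* (g′ :+ p :* g)) refl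
             g g′ (h (suc n)) a (f′ n) (Q ^ suc n) ⟩
      g * (h (suc n) + a * f′ n) + a * f′ n * (g′ + Q ^ suc n * g)
        ≈⟨ +-cong (*-congˡ compare) (*-congˡ (sym (G-absorption n l))) ⟩
      g * (f (suc n) + a * (Q ^ suc n * f′ n)) + a * f′ n * (g + Q ^ suc l * g′)
        ≈⟨ solve 7 (λ g g′ h a f p r →
             g :* (h :+ a :* (p :* f)) :+ a :* f :* (g :+ r :* g′) :=
             g :* h :+ a :* (r :* (g′ :* f)) :+ (g :* (a :* f) :+ g :* (a :* (p :* f)))) refl
             g g′ (f (suc n)) a (f′ n) (Q ^ suc n) (Q ^ suc l) ⟩
      g * f (suc n) + a * (Q ^ suc l * (g′ * f′ n)) +
        (g * (a * f′ n) + g * (a * (Q ^ suc n * f′ n))) ∎)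
      where
      g  = G (suc n) l
      g′ = G n (suc l)
      compare : h (suc n) + a * f′ n ≈ f (suc n) + a * (Q ^ suc n * f′ n)
      compare = begin
        h (suc n) + a * f′ n  ≈⟨ +-congʳ (h-suc n) ⟩
        Q ^ n * (b * h n + a * b * (Q ^ n * f n) + a * (Q ^ suc n * f n)) + a * (Q ^ n * f n)
          ≈⟨ solve 6 (λ a b p r f h →
               p :* (b :* h :+ a :* b :* (p :* f) :+ a :* (r :* f)) :+ a :* (p :* f) :=
               p :* (a :* f :+ b :* h :+ a :* b :* (p :* f)) :+ a :* (r :* (p :* f))) refl
               a b (Q ^ n) (Q ^ suc n) (f n) (h n) ⟩
        Q ^ n * (a * f n + b * h n + a * b * (Q ^ n * f n)) + a * (Q ^ suc n * f′ n)
          ≈⟨ +-congʳ (f-suc n) ⟨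
        f (suc n) + a * (Q ^ suc n * f′ n)  ∎

    -- This eliminates `h`. Summing `difference` leaves `Q ^ l` next to the `Q ^ n` inside `f′`, and
    -- their product is the constant `Q ^ N` on the antidiagonal.
    difference-sum : ∀ N → binomialSum N h + a * binomialSum N f′ ≈ F N + a * (Q ^ N * F N)
    difference-sum zero = +-cong (*-congˡ (trans h-zero (sym f-zero)))
      (*-congˡ (solve 1 (λ x → con 1 :* (con 1 :* x) := con 1 :* (con 1 :* x)) refl (f 0)))
    difference-sum (suc N) = begin
      binomialSum (suc N) h + a * binomialSum (suc N) f′
        -- `h` loses its term at n = 0 and `f′` its term at l = 0, so that both remaining sums run
        -- over n + l = N and `difference` applies term by term.
        ≈⟨ +-cong (+-congʳ (*-congˡ (trans h-zero (sym f-zero))))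
                  (*-congˡ (antidiagonal-last N λ n l → G n l * f′ n)) ⟩
      1# * f 0 + ∑h + a * (antidiagonal N (λ n l → G n (suc l) * f′ n) + e)
        ≈⟨ solve 5 (λ x y a z e → x :+ y :+ a :* (z :+ e) := x :+ (y :+ a :* z) :+ a :* e) refl
             (1# * f 0) ∑h a _ e ⟩
      1# * f 0 + (∑h + a * antidiagonal N (λ n l → G n (suc l) * f′ n)) + a * e
        ≈⟨ +-congʳ (+-congˡ termwise) ⟩
      1# * f 0 + (∑f + a * antidiagonal N (λ n l → t n (suc l))) + a * e
        ≈⟨ solve 5 (λ x y a z e → x :+ (y :+ a :* z) :+ a :* e := x :+ y :+ a :* (z :+ con 1 :* e))
             refl (1# * f 0) ∑f a _ e ⟩
      F (suc N) + a * (antidiagonal N (λ n l → t n (suc l)) + t (suc N) 0)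
        ≈⟨ +-congˡ (*-congˡ (antidiagonal-last N t)) ⟨
      F (suc N) + a * antidiagonal (suc N) t
        ≈⟨ +-congˡ (*-congˡ (trans (antidiagonal-cong (suc N) collect) 
               (antidiagonal-* (suc N) (Q ^ suc N) λ n l → G n l * f n))) ⟩
      F (suc N) + a * (Q ^ suc N * F (suc N)) ∎
      where
      e = G (suc N) 0 * f′ (suc N)
      ∑h = antidiagonal N λ n l → G (suc n) l * h (suc n)
      ∑f = antidiagonal N λ n l → G (suc n) l * f (suc n)
      t : ℕ → ℕ → Carrier
      t n l = Q ^ l * (G n l * f′ n)
      termwise : ∑h + a * antidiagonal N (λ n l → G n (suc l) * f′ n) ≈
                 ∑f + a * antidiagonal N (λ n l → t n (suc l))
      termwise = begin
        _ ≈⟨ +-congˡ (antidiagonal-* N a _) ⟨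
        _ ≈⟨ antidiagonal-+ N _ _ ⟨
        _ ≈⟨ antidiagonal-cong N (λ n l _ → difference n l) ⟩
        _ ≈⟨ antidiagonal-+ N _ _ ⟩
        _ ≈⟨ +-congˡ (antidiagonal-* N a _) ⟩
        _ ∎
      collect : ∀ n l → n ℕ.+ l ≡ suc N → t n l ≈ Q ^ suc N * (G n l * f n)
      collect n l eq = begin
        Q ^ l * (G n l * (Q ^ n * f n))
          ≈⟨ solve 4 (λ p g r x → p :* (g :* (r :* x)) := r :* p :* (g :* x)) refl
               (Q ^ l) (G n l) (Q ^ n) (f n) ⟩
        Q ^ n * Q ^ l * (G n l * f n)  ≈⟨ *-congʳ (^-homo-* Q n l) ⟨
        Q ^ (n ℕ.+ l) * (G n l * f n)  ≡⟨ ≡.cong (λ m → Q ^ m * (G n l * f n)) eq ⟩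
        Q ^ suc N * (G n l * f n)      ∎

    -- The `Q ^ n` of `f-suc` meets the `Q ^ l` of Pascal's rule and gives `Q ^ N` throughout. What
    -- remains of `h` is exactly the left side of `difference-sum`.
    F-suc : ∀ N → F (suc N) ≈ (1# + a * Q ^ N) * (1# + b * Q ^ N) * F N
    F-suc N = begin
      F (suc N)
        ≈⟨ binomialSum-suc N f ⟩
      F N + antidiagonal N (λ n l → Q ^ l * (G n l * f (suc n)))
        ≈⟨ +-congˡ (trans (antidiagonal-cong N expand) (antidiagonal-* N _ _)) ⟩
      F N + Q ^ N * antidiagonal N (λ n l → a * (G n l * f n) + b * (G n l * h n + a * (G n l * f′ n)))
        ≈⟨ +-congˡ (*-congˡ (trans (antidiagonal-+ N _ _) (+-cong (antidiagonal-* N a _)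
             (trans (antidiagonal-* N b _) (*-congˡ (trans (antidiagonal-+ N _ _)
               (+-congˡ (antidiagonal-* N a _)))))))) ⟩
      F N + Q ^ N * (a * F N + b * (binomialSum N h + a * binomialSum N f′))
        ≈⟨ +-congˡ (*-congˡ (+-congˡ (*-congˡ (difference-sum N)))) ⟩
      F N + Q ^ N * (a * F N + b * (F N + a * (Q ^ N * F N)))
        ≈⟨ solve 4 (λ a b p F → F :+ p :* (a :* F :+ b :* (F :+ a :* (p :* F))) :=
             (con 1 :+ a :* p) :* (con 1 :+ b :* p) :* F) refl a b (Q ^ N) (F N) ⟩
      (1# + a * Q ^ N) * (1# + b * Q ^ N) * F N ∎
      where
      expand : ∀ n l → n ℕ.+ l ≡ N → Q ^ l * (G n l * f (suc n)) ≈
        Q ^ N * (a * (G n l * f n) + b * (G n l * h n + a * (G n l * f′ n)))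
      expand n l eq = begin
        Q ^ l * (G n l * f (suc n))
          ≈⟨ *-congˡ (*-congˡ (f-suc n)) ⟩
        Q ^ l * (G n l * (Q ^ n * (a * f n + b * h n + a * b * (Q ^ n * f n))))
          ≈⟨ solve 7 (λ a b p r g f h →
               p :* (g :* (r :* (a :* f :+ b :* h :+ a :* b :* (r :* f)))) :=
               r :* p :* (a :* (g :* f) :+ b :* (g :* h :+ a :* (g :* (r :* f))))) refl
               a b (Q ^ l) (Q ^ n) (G n l) (f n) (h n) ⟩
        Q ^ n * Q ^ l * E              ≈⟨ *-congʳ (^-homo-* Q n l) ⟨
        Q ^ (n ℕ.+ l) * E              ≡⟨ ≡.cong (λ m → Q ^ m * E) eq ⟩
        Q ^ N * E                      ∎
        where E = a * (G n l * f n) + b * (G n l * h n + a * (G n l * f′ n))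

-- Gap conditions as lower bounds and windows.

-- The least part that may follow p.
next : ℕ → ℕ
next zero                = 4
next (suc zero)          = 4
next (suc (suc zero))    = 5
next (suc (suc (suc p))) = 3 ℕ.+ next p

p≤next : ∀ p → p ℕ.≤ next p
p≤next zero                = z≤n
p≤next (suc zero)          = s≤s z≤n
p≤next (suc (suc zero))    = s≤s (s≤s z≤n)
p≤next (suc (suc (suc p))) = ℕ.+-monoʳ-≤ 3 (p≤next p)

-- Three consecutive integers contain each residue mod 3 once, which is why prescribing the residues
-- of the parts determines a chain of windows.
InWindow : ℕ → ℕ → Set
InWindow s y = s ℕ.≤ y × y ℕ.< 3 ℕ.+ s

private
  3∣-shift : ∀ {n} → 3 ∣ n → 3 ∣ 3 ℕ.+ n
  3∣-shift = ∣m∣n⇒∣m+n ∣-refl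

  3∣-unshift : ∀ {n} → 3 ∣ 3 ℕ.+ n → 3 ∣ n
  3∣-unshift d = ∣m+n∣m⇒∣n d ∣-refl

  3∤1 : ¬ 3 ∣ 1
  3∤1 = from-no (3 ∣? 1)

  3∤2 : ¬ 3 ∣ 2
  3∤2 = from-no (3 ∣? 2)

SchurGap⇒next≤ : ∀ p y → SchurGap p y → next p ℕ.≤ y
SchurGap⇒next≤ zero                y                   (_ , g) = g (inj₁ (3 ∣0))
SchurGap⇒next≤ (suc zero)          (suc y)             (g , _) = s≤s g
SchurGap⇒next≤ (suc (suc zero))    (suc (suc y))       (g , _) = s≤s (s≤s g)
SchurGap⇒next≤ (suc (suc (suc p))) (suc (suc (suc y))) (g , g′) =
  ℕ.+-monoʳ-≤ 3 (SchurGap⇒next≤ p y (g , g′ ∘ Sum.map 3∣-shift 3∣-shift))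

next≤⇒SchurGap : ∀ p y → next p ℕ.≤ y → SchurGap p y
next≤⇒SchurGap zero             y 4≤y = ℕ.<⇒≤ 4≤y , λ _ → 4≤y
next≤⇒SchurGap (suc zero)       (suc y) (s≤s 3≤y) = 3≤y ,
  [ (λ d → contradiction d 3∤1)
  , (λ d → ℕ.≤∧≢⇒< 3≤y λ { ≡.refl → 3∤1 (3∣-unshift d) }) ]′
next≤⇒SchurGap (suc (suc zero)) (suc (suc y)) (s≤s (s≤s 3≤y)) = 3≤y ,
  [ (λ d → contradiction d 3∤2)
  , (λ d → ℕ.≤∧≢⇒< 3≤y λ { ≡.refl → 3∤2 (3∣-unshift d) }) ]′
next≤⇒SchurGap (suc (suc (suc p))) (suc (suc (suc y))) (s≤s (s≤s (s≤s le))) =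
  let g , g′ = next≤⇒SchurGap p y le in g , g′ ∘ Sum.map 3∣-unshift 3∣-unshift

-- The range of gaps depends on the residue of `y`, the window on that of `p`. They disagree only at
-- gaps 3 and 6, where the residue of `p` fixes whether 3 divides `y` and so rules the conflict out.
𝓑Gap⇒InWindow : ∀ p y → 𝓑Gap p y → InWindow (next p) y
𝓑Gap⇒InWindow zero y (f , g) with 3 ∣? y
... | no 3∤y  = let l , u = f 3∤y in
                ℕ.≤∧≢⇒< l (λ { ≡.refl → 3∤y ∣-refl }) , s≤s (ℕ.m≤n⇒m≤1+n u)
... | yes 3∣y = let l , u = g 3∣y in l , s≤s u
-- For `y` below `p` the truncated difference is 0, which violates both lower bounds.
𝓑Gap⇒InWindow (suc zero) zero (_ , g) with () ← proj₁ (g (3 ∣0))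
𝓑Gap⇒InWindow (suc zero) (suc y) (f , g) with 3 ∣? suc y
... | no 3∤y  = let l , u = f 3∤y in s≤s l , s≤s (s≤s u)
... | yes 3∣y = let l , u = g 3∣y in ℕ.m≤n⇒m≤1+n l ,
  s≤s (ℕ.≤∧≢⇒< u λ { ≡.refl → 3∤1 (3∣-unshift (3∣-unshift 3∣y)) })
𝓑Gap⇒InWindow (suc (suc zero)) zero (_ , g) with () ← proj₁ (g (3 ∣0))
𝓑Gap⇒InWindow (suc (suc zero)) (suc zero) (f , _) with () ← proj₁ (f 3∤1)
𝓑Gap⇒InWindow (suc (suc zero)) (suc (suc y)) (f , g) with 3 ∣? suc (suc y)
... | no 3∤y  = let l , u = f 3∤y in s≤s (s≤s l) , s≤s (s≤s (s≤s u))
... | yes 3∣y = let l , u = g 3∣y in s≤s (ℕ.m≤n⇒m≤1+n l) ,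
  s≤s (s≤s (ℕ.≤∧≢⇒< u λ { ≡.refl → 3∤2 (3∣-unshift (3∣-unshift 3∣y)) }))
𝓑Gap⇒InWindow (suc (suc (suc p))) zero (_ , g) with () ← proj₁ (g (3 ∣0))
𝓑Gap⇒InWindow (suc (suc (suc p))) (suc zero) (f , _) with () ← proj₁ (f 3∤1)
𝓑Gap⇒InWindow (suc (suc (suc p))) (suc (suc zero)) (f , _) with () ← proj₁ (f 3∤2)
𝓑Gap⇒InWindow (suc (suc (suc p))) (suc (suc (suc y))) (f , g) =
  let l , u = 𝓑Gap⇒InWindow p y ((λ 3∤y → f (3∤y ∘ 3∣-unshift)) , g ∘ 3∣-shift)
  in ℕ.+-monoʳ-≤ 3 l , ℕ.+-monoʳ-≤ 3 u

InWindow⇒𝓑Gap : ∀ p y → InWindow (next p) y → 𝓑Gap p y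
InWindow⇒𝓑Gap zero y (l , s≤s u) =
  (λ 3∤y → ℕ.<⇒≤ l , ℕ.s≤s⁻¹ (ℕ.≤∧≢⇒< u λ { ≡.refl → 3∤y (3∣-shift ∣-refl) })) ,
  (λ _ → l , u)
InWindow⇒𝓑Gap (suc zero) (suc y) (s≤s l , s≤s (s≤s u)) =
  (λ _ → l , u) ,
  (λ 3∣y → ℕ.≤∧≢⇒< l (λ { ≡.refl → 3∤1 (3∣-unshift 3∣y) }) , ℕ.m≤n⇒m≤1+n u)
InWindow⇒𝓑Gap (suc (suc zero)) (suc (suc y)) (s≤s (s≤s l) , s≤s (s≤s (s≤s u))) =
  (λ _ → l , u) ,
  (λ 3∣y → ℕ.≤∧≢⇒< l (λ { ≡.refl → 3∤2 (3∣-unshift 3∣y) }) , ℕ.m≤n⇒m≤1+n u)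
InWindow⇒𝓑Gap (suc (suc (suc p))) (suc (suc (suc y))) (s≤s (s≤s (s≤s l)) , s≤s (s≤s (s≤s u))) =
  let f , g = InWindow⇒𝓑Gap p y (l , u)
  in (λ 3∤y → f (3∤y ∘ 3∣-shift)) , g ∘ 3∣-unshift

-- Chains for ≤ are the Schur partitions, chains for InWindow the elements of 𝓑.
data Chain (_~_ : ℕ → ℕ → Set) (s : ℕ) : List ℕ → Set where
  []  : Chain _~_ s []
  _∷_ : ∀ {y β} → s ~ y → Chain _~_ (next y) β → Chain _~_ s (y ∷ β)

Chain-mono : ∀ {r s β} → r ℕ.≤ s → Chain ℕ._≤_ s β → Chain ℕ._≤_ r β
Chain-mono r≤s []      = []
Chain-mono r≤s (p ∷ c) = ℕ.≤-trans r≤s p ∷ c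

Chain⇒IsPartition : ∀ {s β} → 0 ℕ.< s → Chain ℕ._≤_ s β → IsPartition β
Chain⇒IsPartition 0<s c = positive 0<s c , increasing c
  where
  positive : ∀ {s β} → 0 ℕ.< s → Chain ℕ._≤_ s β → All (0 ℕ.<_) β
  positive 0<s []              = []
  positive 0<s (_∷_ {y} s≤y c) =
    let 0<y = ℕ.<-≤-trans 0<s s≤y in 0<y ∷ positive (ℕ.<-≤-trans 0<y (p≤next y)) c
  increasing : ∀ {s β} → Chain ℕ._≤_ s β → Linked ℕ._≤_ β
  increasing []                      = []
  increasing (_ ∷ [])                = [-]
  increasing (_∷_ {y} _ c@(le ∷ _)) = ℕ.≤-trans (p≤next y) le ∷ increasing c

Schur⇒Chain : ∀ {π} → Schur π → Chain ℕ._≤_ 1 π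
Schur⇒Chain {[]}    _                     = []
Schur⇒Chain {x ∷ π} ((0<x ∷ _ , _) , gaps) = 0<x ∷ go gaps
  where
  go : ∀ {x π} → Linked SchurGap (x ∷ π) → Chain ℕ._≤_ (next x) π
  go [-]               = []
  go (_∷_ {x} {y} g l) = SchurGap⇒next≤ x y g ∷ go l

Chain⇒Schur : ∀ {π} → Chain ℕ._≤_ 1 π → Schur π
Chain⇒Schur c = Chain⇒IsPartition (s≤s z≤n) c , go c
  where
  go : ∀ {s π} → Chain ℕ._≤_ s π → Linked SchurGap π
  go []                   = []
  go (_ ∷ [])             = [-]
  go (_∷_ {x} _ c@(_∷_ {y} le _)) = next≤⇒SchurGap x y le ∷ go c

𝓑⇒Chain : ∀ {β} → 𝓑 β → Chain InWindow 1 β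
𝓑⇒Chain {[]}    _                   = []
𝓑⇒Chain {x ∷ β} (_ , just x∈ , gaps) = first x∈ ∷ go gaps
  where
  first : x ∈ 1 ∷ 2 ∷ 3 ∷ [] → InWindow 1 x
  first (here ≡.refl)                 = s≤s z≤n , s≤s (s≤s z≤n)
  first (there (here ≡.refl))         = s≤s z≤n , s≤s (s≤s (s≤s z≤n))
  first (there (there (here ≡.refl))) = s≤s z≤n , ℕ.≤-refl
  go : ∀ {x π} → Linked 𝓑Gap (x ∷ π) → Chain InWindow (next x) π
  go [-]               = []
  go (_∷_ {x} {y} g l) = 𝓑Gap⇒InWindow x y g ∷ go l

Chain⇒𝓑 : ∀ {β} → Chain InWindow 1 β → 𝓑 β
Chain⇒𝓑 c = Chain⇒IsPartition (s≤s z≤n) (forget c) , first c , go c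
  where
  forget : ∀ {s β} → Chain InWindow s β → Chain ℕ._≤_ s β
  forget []      = []
  forget (w ∷ c) = proj₁ w ∷ forget c
  first : ∀ {β} → Chain InWindow 1 β → Maybe.All (_∈ 1 ∷ 2 ∷ 3 ∷ []) (head β)
  first []                                              = nothing
  first (_∷_ {suc zero} _ _)                            = just (here ≡.refl)
  first (_∷_ {suc (suc zero)} _ _)                      = just (there (here ≡.refl))
  first (_∷_ {suc (suc (suc zero))} _ _)                = just (there (there (here ≡.refl)))
  first (_∷_ {suc (suc (suc (suc y)))} (_ , s≤s (s≤s (s≤s (s≤s ())))) _)
  go : ∀ {s π} → Chain InWindow s π → Linked 𝓑Gap π
  go []               = []
  go (_ ∷ [])         = [-]
  go (_∷_ {x} _ c@(_∷_ {y} w _)) = InWindow⇒𝓑Gap x y w ∷ go c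

-- Enumeration of the partitions β + 3λ.

-- The partitions β + 3λ with n parts, where β is a chain of windows starting at s and
-- the parts of λ are at most l.  Moving s to s + 3 adds 3 to all remaining parts and
-- uses up one unit of l.
family : ℕ → ℕ → ℕ → List (List ℕ)
prepend : ℕ → ℕ → ℕ → List (List ℕ)
extend : ℕ → ℕ → ℕ → List (List ℕ) → List (List ℕ)

family zero    _       _ = [] ∷ []
family (suc n) zero    s = extend n zero s []
family (suc n) (suc l) s = extend n (suc l) s (family (suc n) l (3 ℕ.+ s))

prepend n l p = map (p ∷_) (family n l (next p))

extend n l s rest = prepend n l s ++ prepend n l (1 ℕ.+ s) ++ prepend n l (2 ℕ.+ s) ++ rest

private
  extend-All : ∀ {P : List ℕ → Set} n l s {rest} →
    (∀ p → InWindow s p → All (P ∘ (p ∷_)) (family n l (next p))) → All P rest →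
    All P (extend n l s rest)
  extend-All n l s ps rs =
    Allₚ.++⁺ (Allₚ.map⁺ (ps s (ℕ.≤-refl , ℕ.m≤n+m (1 ℕ.+ s) 2)))
    (Allₚ.++⁺ (Allₚ.map⁺ (ps (1 ℕ.+ s) (ℕ.n≤1+n s , ℕ.n≤1+n (2 ℕ.+ s))))
    (Allₚ.++⁺ (Allₚ.map⁺ (ps (2 ℕ.+ s) (ℕ.m≤n+m s 2 , ℕ.≤-refl))) rs))

family-length : ∀ n l s → All (λ β → length β ≡ n) (family n l s)
family-length zero    l       s = ≡.refl ∷ []
family-length (suc n) zero    s = extend-All n zero s
  (λ p _ → All.map (≡.cong suc) (family-length n zero (next p))) []
family-length (suc n) (suc l) s = extend-All n (suc l) s
  (λ p _ → All.map (≡.cong suc) (family-length n (suc l) (next p)))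
  (family-length (suc n) l (3 ℕ.+ s))

family-≤-chain : ∀ n l s → All (Chain ℕ._≤_ s) (family n l s)
family-≤-chain zero    l       s = [] ∷ []
family-≤-chain (suc n) zero    s = extend-All n zero s
  (λ p (s≤p , _) → All.map (s≤p ∷_) (family-≤-chain n zero (next p))) []
family-≤-chain (suc n) (suc l) s = extend-All n (suc l) s
  (λ p (s≤p , _) → All.map (s≤p ∷_) (family-≤-chain n (suc l) (next p)))
  (All.map (Chain-mono (ℕ.m≤n+m s 3)) (family-≤-chain (suc n) l (3 ℕ.+ s)))

family-window-chain : ∀ n s → All (Chain InWindow s) (family n 0 s)
family-window-chain zero    s = [] ∷ []
family-window-chain (suc n) s = extend-All n 0 s
  (λ p w → All.map (w ∷_) (family-window-chain n (next p))) []

private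
  ∈-extend : ∀ n l {s p β rest} → InWindow s p → β ∈ family n l (next p) →
             p ∷ β ∈ extend n l s rest
  ∈-extend n l {s} {p} (s≤p , p<3+s) β∈ with ℕ.m≤n⇒m<n∨m≡n s≤p
  ... | inj₂ ≡.refl = ∈-++⁺ˡ (∈-map⁺ (p ∷_) β∈)
  ... | inj₁ 1+s≤p with ℕ.m≤n⇒m<n∨m≡n 1+s≤p
  ...   | inj₂ ≡.refl = ∈-++⁺ʳ (prepend n l s) (∈-++⁺ˡ (∈-map⁺ (p ∷_) β∈))
  ...   | inj₁ 2+s≤p with ≡.refl ← ℕ.≤-antisym 2+s≤p (ℕ.s≤s⁻¹ p<3+s) =
    ∈-++⁺ʳ (prepend n l s) (∈-++⁺ʳ (prepend n l (1 ℕ.+ s)) (∈-++⁺ˡ (∈-map⁺ (p ∷_) β∈)))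

  ∈-extend-rest : ∀ n l s {β rest} → β ∈ rest → β ∈ extend n l s rest
  ∈-extend-rest n l s β∈ = ∈-++⁺ʳ (prepend n l s) (∈-++⁺ʳ (prepend n l (1 ℕ.+ s))
    (∈-++⁺ʳ (prepend n l (2 ℕ.+ s)) β∈))

window-chain-∈ : ∀ {s β} → Chain InWindow s β → β ∈ family (length β) 0 s
window-chain-∈ []      = here ≡.refl
window-chain-∈ (_∷_ {β = β} w c) = ∈-extend (length β) 0 w (window-chain-∈ c)

-- The size bounds every part, and `l + s` never decreases along the recursion: taking a part raises
-- `s`, and a shift trades one unit of `l` for three of `s`. When `l` is 0 no shift is required,
-- since the least part is then at most `s`.
≤-chain-∈ : ∀ {s β} l → Chain ℕ._≤_ s β → size β ℕ.≤ l ℕ.+ s → β ∈ family (length β) l s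
≤-chain-∈         l []  _ = here ≡.refl
≤-chain-∈ {s} {p ∷ β} l (s≤p ∷ c) small with p ℕ.<? 3 ℕ.+ s | l
... | yes p<3+s | zero   = ∈-extend (length β) 0 (s≤p , p<3+s) (≤-chain-∈ 0 c
        (ℕ.≤-trans (ℕ.m≤n+m (size β) p) (ℕ.≤-trans small (ℕ.≤-trans s≤p (p≤next p)))))
... | yes p<3+s | suc l′ = ∈-extend (length β) (suc l′) (s≤p , p<3+s) (≤-chain-∈ (suc l′) c
        (ℕ.≤-trans (ℕ.m≤n+m (size β) p) (ℕ.≤-trans small
          (ℕ.+-monoʳ-≤ (suc l′) (ℕ.≤-trans s≤p (p≤next p))))))
... | no p≮3+s  | zero   = contradiction
        (ℕ.≤-<-trans (ℕ.≤-trans (ℕ.m≤m+n p (size β)) small) (ℕ.m≤n+m (1 ℕ.+ s) 2)) p≮3+s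
... | no p≮3+s  | suc l′ = ∈-extend-rest (length β) (suc l′) s
        (≤-chain-∈ l′ (ℕ.≮⇒≥ p≮3+s ∷ c) (ℕ.≤-trans small (ℕ.≤-trans
          (ℕ.+-monoʳ-≤ (suc l′) (ℕ.m≤n+m s 2)) (ℕ.≤-reflexive (≡.sym (ℕ.+-suc l′ (2 ℕ.+ s)))))))

private
  prepend-chain : ∀ n l p {s rest} → s ℕ.≤ p → All (Chain ℕ._≤_ s) rest →
                  All (Chain ℕ._≤_ s) (prepend n l p ++ rest)
  prepend-chain n l p s≤p rs =
    Allₚ.++⁺ (Allₚ.map⁺ (All.map (s≤p ∷_) (family-≤-chain n l (next p)))) rs

  -- Blocks are separated by their least part, because the lists that follow can only begin above
  -- `p`.
  prepend-unique : ∀ n l p {rest} → Unique (family n l (next p)) → Unique rest →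
                   All (Chain ℕ._≤_ (suc p)) rest → Unique (prepend n l p ++ rest)
  prepend-unique n l p {rest} u urest later =
    Uniqueₚ.++⁺ (Uniqueₚ.map⁺ ∷-injectiveʳ u) urest λ (β∈ , β∈rest) →
      disjoint β∈ (All.lookup later β∈rest)
    where
    disjoint : ∀ {β} → β ∈ prepend n l p → ¬ Chain ℕ._≤_ (suc p) β
    disjoint β∈ c with _ , _ , ≡.refl ← ∈-map⁻ (p ∷_) β∈ | p<p ∷ _ ← c = ℕ.<-irrefl ≡.refl p<p

  extend-unique : ∀ n l s {rest} → (∀ p → Unique (family n l p)) → Unique rest →
                  All (Chain ℕ._≤_ (3 ℕ.+ s)) rest → Unique (extend n l s rest)
  extend-unique n l s u urest later =
    prepend-unique n l s (u _)
      (prepend-unique n l (1 ℕ.+ s) (u _)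
        (prepend-unique n l (2 ℕ.+ s) (u _) urest later)
        (prepend-chain n l (2 ℕ.+ s) ℕ.≤-refl (All.map (Chain-mono (ℕ.n≤1+n _)) later)))
      (prepend-chain n l (1 ℕ.+ s) ℕ.≤-refl (prepend-chain n l (2 ℕ.+ s) (ℕ.n≤1+n _)
        (All.map (Chain-mono (ℕ.m≤n+m _ 2)) later)))

family-unique : ∀ n l s → Unique (family n l s)
family-unique zero    l       s = [] ∷ []
family-unique (suc n) zero    s = extend-unique n zero s (family-unique n zero) [] []
family-unique (suc n) (suc l) s = extend-unique n (suc l) s (family-unique n (suc l))
  (family-unique (suc n) l (3 ℕ.+ s)) (family-≤-chain (suc n) l (3 ℕ.+ s))

-- Finite lists exhausting the Schur partitions.

antidiagonalList : {A : Set} → ℕ → (ℕ → ℕ → List A) → List A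
antidiagonalList zero    t = t 0 0
antidiagonalList (suc N) t = t 0 (suc N) ++ antidiagonalList N (t ∘ suc)

antidiagonalList-All : ∀ {A : Set} {P : A → Set} N {t} → (∀ n l → All P (t n l)) →
                       All P (antidiagonalList N t)
antidiagonalList-All zero    ps = ps 0 0
antidiagonalList-All (suc N) ps = Allₚ.++⁺ (ps 0 (suc N)) (antidiagonalList-All N (ps ∘ suc))

∈-antidiagonalList : ∀ {A : Set} {x : A} {t} n l → x ∈ t n l → x ∈ antidiagonalList (n ℕ.+ l) t
∈-antidiagonalList zero    zero    x∈ = x∈
∈-antidiagonalList zero    (suc l) x∈ = ∈-++⁺ˡ x∈
∈-antidiagonalList {t = t} (suc n) l x∈ = ∈-++⁺ʳ (t 0 (suc n ℕ.+ l)) (∈-antidiagonalList n l x∈)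

-- `d` tells the blocks apart. The offset `k` is there for the induction, which drops block 0 and
-- renumbers the others.
antidiagonalList-unique : ∀ {A : Set} (d : A → ℕ) N k {t} → (∀ n l → Unique (t n l)) →
  (∀ n l → All (λ x → d x ≡ k ℕ.+ n) (t n l)) → Unique (antidiagonalList N t)
antidiagonalList-unique d zero    k     us ds = us 0 0
antidiagonalList-unique d (suc N) k {t} us ds = Uniqueₚ.++⁺ (us 0 (suc N))
  (antidiagonalList-unique d N (suc k) (us ∘ suc)
    λ n l → All.map (λ eq → ≡.trans eq (ℕ.+-suc k n)) (ds (suc n) l))
  λ (x∈ , x∈′) → ℕ.<⇒≢
    (All.lookup (antidiagonalList-All {P = λ x → k ℕ.< d x} N {t ∘ suc}
      λ n l → All.map (λ eq → ≡.subst (k ℕ.<_) (≡.sym eq) (ℕ.m<m+n k (s≤s z≤n))) (ds (suc n) l)) x∈′)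
    (≡.sym (≡.trans (All.lookup (ds 0 (suc N)) x∈) (ℕ.+-identityʳ k)))

schurFamily : ℕ → List (List ℕ)
schurFamily N = antidiagonalList N λ n l → family n l 1

schurFamily-unique : ∀ N → Unique (schurFamily N)
schurFamily-unique N = antidiagonalList-unique length N 0
  (λ n l → family-unique n l 1) (λ n l → family-length n l 1)

schurFamily-Schur : ∀ N → All Schur (schurFamily N)
schurFamily-Schur N = antidiagonalList-All N λ n l → All.map Chain⇒Schur (family-≤-chain n l 1)

length≤size : ∀ {β} → All (0 ℕ.<_) β → length β ℕ.≤ size β
length≤size []       = z≤n
length≤size (p ∷ ps) = ℕ.+-mono-≤ p (length≤size ps)

-- A partition has at most `size π` parts, so at least `size π` is left of `N` as the bound on λ,
-- enough for `≤-chain-∈`.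
schurFamily-complete : ∀ {N π} → Schur π → size π ℕ.+ size π ℕ.≤ N → π ∈ schurFamily N
schurFamily-complete {N} {π} s@((pos , _) , _) small =
  ≡.subst (λ M → π ∈ schurFamily M) (ℕ.m+[n∸m]≡n n≤N)
    (∈-antidiagonalList n (N ℕ.∸ n) (≤-chain-∈ (N ℕ.∸ n) (Schur⇒Chain s)
      (ℕ.≤-trans (ℕ.m+n≤o⇒m≤o∸n (size π) (ℕ.≤-trans (ℕ.+-monoʳ-≤ (size π) (length≤size pos)) small))
                 (ℕ.m≤m+n (N ℕ.∸ n) 1))))
  where
  n = length π
  n≤N : n ℕ.≤ N
  n≤N = ℕ.≤-trans (length≤size pos) (ℕ.≤-trans (ℕ.m≤m+n (size π) (size π)) small)

∈-family⇒𝓑OfLength : ∀ n β → β ∈ family n 0 1 → 𝓑OfLength n β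
∈-family⇒𝓑OfLength n β β∈ =
  Chain⇒𝓑 (All.lookup (family-window-chain n 1) β∈) , All.lookup (family-length n 0 1) β∈

𝓑OfLength⇒∈-family : ∀ {n β} → 𝓑OfLength n β → β ∈ family n 0 1
𝓑OfLength⇒∈-family (b , ≡.refl) = window-chain-∈ (𝓑⇒Chain b)

-- Power series modulo powers of q.

module Truncation {c ℓ} (K : CommutativeRing c ℓ) where

  open PowerSeries K
  private
    module K where
      open CommutativeRing K public
      open SemiringSum semiring public using (sum-cong-≋)
    module S where
      open CommutativeRing commutativeRing public
      open SemiringExp semiring public using (_^_)

  infix 4 _≈[_]_

  -- Congruence modulo the k-th power of `X`; divisibility by that power is expressed as
  -- `f ≈[ k ] S.0#`.
  _≈[_]_ : Series → ℕ → Series → Set ℓ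
  f ≈[ k ] g = ∀ j → j ℕ.< k → f j K.≈ g j

  ≈⇒≈[] : ∀ {k f g} → f S.≈ g → f ≈[ k ] g
  ≈⇒≈[] f≈g j _ = f≈g j

  ≈[]-weaken : ∀ {j k f g} → j ℕ.≤ k → f ≈[ k ] g → f ≈[ j ] g
  ≈[]-weaken j≤k f≈g i i<j = f≈g i (ℕ.<-≤-trans i<j j≤k)

  ≈[]-trans : ∀ {k f g h} → f ≈[ k ] g → g ≈[ k ] h → f ≈[ k ] h
  ≈[]-trans f≈g g≈h j j<k = K.trans (f≈g j j<k) (g≈h j j<k)

  ≈[]-sym : ∀ {k f g} → f ≈[ k ] g → g ≈[ k ] f
  ≈[]-sym f≈g j j<k = K.sym (f≈g j j<k)

  +-cong-≈[] : ∀ {k f f′ g g′} → f ≈[ k ] f′ → g ≈[ k ] g′ → f S.+ g ≈[ k ] f′ S.+ g′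
  +-cong-≈[] p q j j<k = K.+-cong (p j j<k) (q j j<k)

  *-cong-≈[] : ∀ {k f f′ g g′} → f ≈[ k ] f′ → g ≈[ k ] g′ → f S.* g ≈[ k ] f′ S.* g′
  *-cong-≈[] p q j j<k = K.sum-cong-≋ {suc j} λ i → K.*-cong
    (p (toℕ i) (ℕ.≤-<-trans (Fin.toℕ≤pred[n] i) j<k))
    (q (j ℕ.∸ toℕ i) (ℕ.≤-<-trans (ℕ.m∸n≤m j (toℕ i)) j<k))

  -- A factor of order `m` delays an error of order `n` to order `m + n`: in each term of the
  -- convolution either `i < m`, where `f` vanishes, or `j - i < n`, where `g` and `h` agree.
  *-order : ∀ {m n f g h} → f ≈[ m ] S.0# → g ≈[ n ] h → f S.* g ≈[ m ℕ.+ n ] f S.* h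
  *-order {m} {n} {f} {g} {h} f≈0 g≈h j j<m+n =
    K.sum-cong-≋ {suc j} λ i → term (toℕ i) (Fin.toℕ≤pred[n] i)
    where
    term : ∀ i → i ℕ.≤ j → f i K.* g (j ℕ.∸ i) K.≈ f i K.* h (j ℕ.∸ i)
    term i i≤j with i ℕ.<? m
    ... | yes i<m = K.trans (vanish g) (K.sym (vanish h))
      where
      vanish : ∀ x → f i K.* x (j ℕ.∸ i) K.≈ K.0#
      vanish x = K.trans (K.*-congʳ (f≈0 i i<m)) (K.zeroˡ _)
    ... | no i≮m  = K.*-congˡ (g≈h (j ℕ.∸ i) (≡.subst (j ℕ.∸ i ℕ.<_) (ℕ.m+n∸m≡n m n)
        (ℕ.≤-<-trans (ℕ.∸-monoʳ-≤ j (ℕ.≮⇒≥ i≮m)) (ℕ.∸-monoˡ-< j<m+n (ℕ.≤-trans (ℕ.≮⇒≥ i≮m) i≤j)))))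

  *-order-0 : ∀ {m n f g} → f ≈[ m ] S.0# → g ≈[ n ] S.0# → f S.* g ≈[ m ℕ.+ n ] S.0#
  *-order-0 {f = f} f≈0 g≈0 = ≈[]-trans (*-order {f = f} f≈0 g≈0) (≈⇒≈[] (S.zeroʳ f))

  *-vanishˡ : ∀ {n} f {g} → g ≈[ n ] S.0# → f S.* g ≈[ n ] S.0#
  *-vanishˡ f g≈0 = *-order-0 {0} {f = f} (λ _ ()) g≈0

  X-order : X ≈[ 1 ] S.0#
  X-order zero    _ = K.refl
  X-order (suc _) (s≤s ())

  X^-order : ∀ n → X S.^ n ≈[ n ] S.0#
  X^-order zero    = λ _ ()
  X^-order (suc n) = *-order-0 {1} {f = X} X-order (X^-order n)

  module _ {A : Set} (w : A → Series) where

    sumList-↭ : ∀ {xs ys} → xs ↭ ys → sumList w xs S.≈ sumList w ys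
    sumList-↭ ↭.refl         = S.refl
    sumList-↭ (↭.prep x p)   = S.+-congˡ (sumList-↭ p)
    sumList-↭ (↭.swap x y p) = S.trans (S.sym (S.+-assoc (w x) (w y) _))
      (S.trans (S.+-cong (S.+-comm (w x) (w y)) (sumList-↭ p)) (S.+-assoc (w y) (w x) _))
    sumList-↭ (↭.trans p q)  = S.trans (sumList-↭ p) (sumList-↭ q)

    -- Serves two purposes: sums over two listings of the same set agree, and enlarging a finite set
    -- by elements that do not reach coefficient `k` changes nothing there.
    sumList-⊆ : ∀ k {xs ys} → Unique xs → Unique ys → xs ⊆ ys →
                (∀ {y} → y ∈ ys → y ∈ xs ⊎ w y k K.≈ K.0#) →
                sumList w ys k K.≈ sumList w xs k
    sumList-⊆ k {[]}         {[]}     _  _        _     _    = K.refl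
    sumList-⊆ k {[]}         {y ∷ ys} [] (_ ∷ uys) _    zeros = K.trans
      (K.+-cong (zero-at (zeros (here ≡.refl)))
                (sumList-⊆ k [] uys (λ ()) (λ y∈ → zeros (there y∈))))
      (K.+-identityˡ K.0#)
      where
      zero-at : y ∈ [] ⊎ w y k K.≈ K.0# → w y k K.≈ K.0#
      zero-at (inj₂ wy≈0) = wy≈0
    sumList-⊆ k {xs = x ∷ xs} {ys} (x∉xs ∷ uxs) uys xs⊆ys zeros
      with l , r , ≡.refl ← ∈-∃++ (xs⊆ys (here ≡.refl)) = split
      where
      σ : l ++ x ∷ r ↭ x ∷ l ++ r
      σ = shift x l r
      split : sumList w (l ++ x ∷ r) k K.≈ sumList w (x ∷ xs) k
      split with x∉ ∷ u ← Permutationₛ.Unique-resp-↭ (≡.setoid A) (↭⇒↭ₛ σ) uys =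
        K.trans (sumList-↭ σ k) (K.+-congˡ (sumList-⊆ k uxs u sub zeros′))
        where
        sub : xs ⊆ l ++ r
        sub y∈xs with ∈-resp-↭ σ (xs⊆ys (there y∈xs))
        ... | here ≡.refl = contradiction ≡.refl (All.lookup x∉xs y∈xs)
        ... | there y∈  = y∈
        zeros′ : ∀ {y} → y ∈ l ++ r → y ∈ xs ⊎ w y k K.≈ K.0#
        zeros′ y∈ with zeros (∈-resp-↭ (↭-sym σ) (there y∈))
        ... | inj₁ (here ≡.refl)  = contradiction ≡.refl (All.lookup x∉ y∈)
        ... | inj₁ (there y∈xs) = inj₁ y∈xs
        ... | inj₂ wy≈0         = inj₂ wy≈0

-- Generating functions of the families.

count≡-shift : ∀ r s p β → count≡ r s (3 ℕ.+ p ∷ β) ≡ count≡ r s (p ∷ β)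
-- `(3 + p) % 3` computes to `p % 3`, so both filters branch on the same test.
count≡-shift r s p β with does ((p % 3 ℕ.≟ r) ⊎-dec (p % 3 ℕ.≟ s))
... | true  = ≡.refl
... | false = ≡.refl

module FamilySum {c ℓ} (R : CommutativeRing c ℓ) (u v q : CommutativeRing.Carrier R) where

  open CommutativeRing R hiding (zero)
  open RingProperties ring
  open SemiringExp semiring using (_^_; ^-homo-*; ^-assocʳ; ^-congʳ)
  open MonoidSum *-commutativeMonoid using () renaming
    (sum to product; sum-cong-≋ to product-cong; sum-init-last to product-init-last;
     ∑-distrib-+ to product-distrib-*)
  open SemiringSolver commutativeSemiring using (solve; _:=_; _:+_; _:*_; con)
  open SetoidReasoning setoid

  -- `a` and `b` are the weights of the parts 1 and 2. The part 3 has weight `a * b`, and adding 3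
  -- to a part multiplies its weight by `Q`.
  Q a b : Carrier
  Q = q ^ 3
  a = u * q
  b = v * q ^ 2

  open QBinomial R Q

  -- Restated over an arbitrary ring; over power series in `q`, `weight`, `total` and `pochhammer`
  -- unfold to the notions of the theorem.
  weight : List ℕ → Carrier
  weight β = u ^ count≡ 0 1 β * v ^ count≡ 0 2 β * q ^ size β

  total : List (List ℕ) → Carrier
  total xs = foldr _+_ 0# (map weight xs)

  total-++ : ∀ xs ys → total (xs ++ ys) ≈ total xs + total ys
  total-++ []       ys = sym (+-identityˡ _)
  total-++ (β ∷ xs) ys = trans (+-congˡ (total-++ xs ys)) (sym (+-assoc _ _ _))

  partWeight : ℕ → Carrier
  partWeight zero                = u * v
  partWeight (suc zero)          = u * q
  partWeight (suc (suc zero))    = v * q ^ 2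
  partWeight (suc (suc (suc p))) = Q * partWeight p

  weight-∷ : ∀ p β → weight (p ∷ β) ≈ partWeight p * weight β
  weight-∷ zero β =
    solve 5 (λ u v x y z → u :* x :* (v :* y) :* z := u :* v :* (x :* y :* z)) refl
      u v _ _ _
  weight-∷ (suc zero) β =
    solve 5 (λ u q x y z → u :* x :* y :* (q :* z) := u :* q :* (x :* y :* z)) refl
      u q _ _ _
  weight-∷ (suc (suc zero)) β =
    solve 5 (λ v q x y z → x :* (v :* y) :* (q :* (q :* z)) :=
                           v :* (q :* (q :* con 1)) :* (x :* y :* z)) refl
      v q _ _ _
  weight-∷ (suc (suc (suc p))) β = begin
    weight (3 ℕ.+ p ∷ β)
      ≈⟨ *-cong (*-cong (^-congʳ u (count≡-shift 0 1 p β)) (^-congʳ v (count≡-shift 0 2 p β))) refl ⟩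
    u ^ count≡ 0 1 (p ∷ β) * v ^ count≡ 0 2 (p ∷ β) * q ^ (3 ℕ.+ size (p ∷ β))
      ≈⟨ solve 3 (λ q x z → x :* (q :* (q :* (q :* z))) :=
                            q :* (q :* (q :* con 1)) :* (x :* z)) refl q _ _ ⟩
    Q * weight (p ∷ β)              ≈⟨ *-congˡ (weight-∷ p β) ⟩
    Q * (partWeight p * weight β)   ≈⟨ *-assoc Q (partWeight p) (weight β) ⟨
    Q * partWeight p * weight β     ∎

  total-map : ∀ p xs → total (map (p ∷_) xs) ≈ partWeight p * total xs
  total-map p []       = sym (zeroʳ _)
  total-map p (β ∷ xs) = trans (+-cong (weight-∷ p β) (total-map p xs))
    (sym (distribˡ (partWeight p) _ _))

  S⟨_,_,_⟩ : ℕ → ℕ → ℕ → Carrier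
  S⟨ n , l , s ⟩ = total (family n l s)

  extension : ℕ → ℕ → ℕ → Carrier
  extension n l s =
    partWeight s * S⟨ n , l , next s ⟩ +
    (partWeight (1 ℕ.+ s) * S⟨ n , l , next (1 ℕ.+ s) ⟩ +
     partWeight (2 ℕ.+ s) * S⟨ n , l , next (2 ℕ.+ s) ⟩)

  total-extend : ∀ n l s rest → total (extend n l s rest) ≈ extension n l s + total rest
  total-extend n l s rest = begin
    total (extend n l s rest)
      ≈⟨ step s _ ⟩
    w 0 + total (prepend n l (1 ℕ.+ s) ++ prepend n l (2 ℕ.+ s) ++ rest)
      ≈⟨ +-congˡ {w 0} (step (1 ℕ.+ s) _) ⟩
    w 0 + (w 1 + total (prepend n l (2 ℕ.+ s) ++ rest))
      ≈⟨ +-congˡ {w 0} (+-congˡ {w 1} (step (2 ℕ.+ s) rest)) ⟩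
    w 0 + (w 1 + (w 2 + total rest))
      ≈⟨ solve 4 (λ x y z t → x :+ (y :+ (z :+ t)) := x :+ (y :+ z) :+ t) refl
           (w 0) (w 1) (w 2) (total rest) ⟩
    extension n l s + total rest ∎
    where
    w : ℕ → Carrier
    w i = partWeight (i ℕ.+ s) * S⟨ n , l , next (i ℕ.+ s) ⟩
    step : ∀ p rest′ → total (prepend n l p ++ rest′) ≈ partWeight p * S⟨ n , l , next p ⟩ + total rest′
    step p rest′ = trans (total-++ (prepend n l p) rest′)
      (+-congʳ (total-map p (family n l (next p))))

  S-suc-zero : ∀ n s → S⟨ suc n , 0 , s ⟩ ≈ extension n 0 s
  S-suc-zero n s = trans (total-extend n 0 s []) (+-identityʳ _)

  S-suc-suc : ∀ n l s → S⟨ suc n , suc l , s ⟩ ≈ extension n (suc l) s + S⟨ suc n , l , 3 ℕ.+ s ⟩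
  S-suc-suc n l s = total-extend n (suc l) s (family (suc n) l (3 ℕ.+ s))

  extension-cong : ∀ n l l′ s s′ x y → (∀ i → partWeight (i ℕ.+ s) ≈ x * partWeight (i ℕ.+ s′)) →
    (∀ i → S⟨ n , l , next (i ℕ.+ s) ⟩ ≈ y * S⟨ n , l′ , next (i ℕ.+ s′) ⟩) →
    extension n l s ≈ x * y * extension n l′ s′
  extension-cong n l l′ s s′ x y pw≈ S≈ = trans
    (+-cong (*-cong (pw≈ 0) (S≈ 0)) (+-cong (*-cong (pw≈ 1) (S≈ 1)) (*-cong (pw≈ 2) (S≈ 2))))
    (solve 8 (λ x y a b c d e f →
       x :* a :* (y :* b) :+ (x :* c :* (y :* d) :+ x :* e :* (y :* f)) :=
       x :* y :* (a :* b :+ (c :* d :+ e :* f))) refl x y _ _ _ _ _ _)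

  -- Adding 3 to each of the `n` parts preserves all residues and gaps and multiplies the weight by
  -- `Q ^ n`.
  S-shift : ∀ n l s → S⟨ n , l , 3 ℕ.+ s ⟩ ≈ Q ^ n * S⟨ n , l , s ⟩
  extension-shift : ∀ n l s → extension n l (3 ℕ.+ s) ≈ Q ^ suc n * extension n l s

  S-shift zero    l       s = sym (*-identityˡ _)
  S-shift (suc n) zero    s = trans (S-suc-zero n (3 ℕ.+ s))
    (trans (extension-shift n 0 s) (*-congˡ (sym (S-suc-zero n s))))
  S-shift (suc n) (suc l) s = begin
    S⟨ suc n , suc l , 3 ℕ.+ s ⟩
      ≈⟨ S-suc-suc n l (3 ℕ.+ s) ⟩
    extension n (suc l) (3 ℕ.+ s) + S⟨ suc n , l , 6 ℕ.+ s ⟩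
      ≈⟨ +-cong (extension-shift n (suc l) s) (S-shift (suc n) l (3 ℕ.+ s)) ⟩
    Q ^ suc n * extension n (suc l) s + Q ^ suc n * S⟨ suc n , l , 3 ℕ.+ s ⟩
      ≈⟨ distribˡ (Q ^ suc n) _ _ ⟨
    Q ^ suc n * (extension n (suc l) s + S⟨ suc n , l , 3 ℕ.+ s ⟩)
      ≈⟨ *-congˡ (S-suc-suc n l s) ⟨
    Q ^ suc n * S⟨ suc n , suc l , s ⟩ ∎

  extension-shift n l s = extension-cong n l l (3 ℕ.+ s) s Q (Q ^ n)
    (λ i → reflexive (≡.cong partWeight (i+3+s≡3+i+s i)))
    (λ i → trans (reflexive (≡.cong (λ p → S⟨ n , l , next p ⟩) (i+3+s≡3+i+s i)))
                 (S-shift n l (next (i ℕ.+ s))))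
    where
    i+3+s≡3+i+s : ∀ i → i ℕ.+ (3 ℕ.+ s) ≡ 3 ℕ.+ (i ℕ.+ s)
    i+3+s≡3+i+s i = ≡.trans (≡.sym (ℕ.+-assoc i 3 s)) (≡.cong (ℕ._+ s) (ℕ.+-comm i 3))

  -- `family` and `G` obey the same recursion: choosing a part in the window gives `G n (suc l)`,
  -- and moving the window gives `Q ^ suc n * G (suc n) l` by `S-shift`.
  S-binomial : ∀ n l s → S⟨ n , l , s ⟩ ≈ G n l * S⟨ n , 0 , s ⟩
  S-binomial zero    l       s = sym (*-identityˡ _)
  S-binomial (suc n) zero    s = sym (*-identityˡ _)
  S-binomial (suc n) (suc l) s = begin
    S⟨ suc n , suc l , s ⟩
      ≈⟨ S-suc-suc n l s ⟩
    extension n (suc l) s + S⟨ suc n , l , 3 ℕ.+ s ⟩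
      ≈⟨ +-cong
           (extension-cong n (suc l) 0 s s 1# (G n (suc l)) (λ i → sym (*-identityˡ _))
             (λ i → S-binomial n (suc l) (next (i ℕ.+ s))))
           (trans (S-shift (suc n) l s) (*-congˡ (S-binomial (suc n) l s))) ⟩
    1# * G n (suc l) * extension n 0 s + Q ^ suc n * (G (suc n) l * S⟨ suc n , 0 , s ⟩)
      ≈⟨ +-congʳ (*-congˡ (S-suc-zero n s)) ⟨
    1# * G n (suc l) * S⟨ suc n , 0 , s ⟩ + Q ^ suc n * (G (suc n) l * S⟨ suc n , 0 , s ⟩)
      ≈⟨ solve 4 (λ g p h x → con 1 :* g :* x :+ p :* (h :* x) := (p :* h :+ g) :* x) refl
           (G n (suc l)) (Q ^ suc n) (G (suc n) l) S⟨ suc n , 0 , s ⟩ ⟩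
    G (suc n) (suc l) * S⟨ suc n , 0 , s ⟩ ∎

  -- Two sequences suffice, since `next` only takes values congruent to 1 or 2 mod 3 and `S-shift`
  -- reduces every such window to one starting at 1 or 2.
  f h : ℕ → Carrier
  f n = S⟨ n , 0 , 1 ⟩
  h n = S⟨ n , 0 , 2 ⟩

  weight-[] : total ([] ∷ []) ≈ 1#
  weight-[] = trans (+-identityʳ _) (trans (*-identityʳ _) (*-identityʳ _))

  S₇ : ∀ n → S⟨ n , 0 , 7 ⟩ ≈ Q ^ n * (Q ^ n * f n)
  S₇ n = trans (S-shift n 0 4) (*-congˡ (S-shift n 0 1))

  f-suc : ∀ n → f (suc n) ≈ Q ^ n * (a * f n + b * h n + a * b * (Q ^ n * f n))
  f-suc n = begin
    f (suc n)  ≈⟨ S-suc-zero n 1 ⟩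
    -- The least part is 1, 2 or 3, and the windows after these start at 4, 5 and 7.
    a * S⟨ n , 0 , 4 ⟩ + (b * S⟨ n , 0 , 5 ⟩ + Q * (u * v) * S⟨ n , 0 , 7 ⟩)
      ≈⟨ +-cong (*-congˡ (S-shift n 0 1))
           (+-cong (*-congˡ (S-shift n 0 2)) (*-congˡ (S₇ n))) ⟩
    a * (Q ^ n * f n) + (b * (Q ^ n * h n) + Q * (u * v) * (Q ^ n * (Q ^ n * f n)))
      ≈⟨ solve 6 (λ u v q p f h →
           u :* q :* (p :* f) :+ (v :* (q :* (q :* con 1)) :* (p :* h) :+
             q :* (q :* (q :* con 1)) :* (u :* v) :* (p :* (p :* f))) :=
           p :* (u :* q :* f :+ v :* (q :* (q :* con 1)) :* h :+
             u :* q :* (v :* (q :* (q :* con 1))) :* (p :* f))) refl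
           u v q (Q ^ n) (f n) (h n) ⟩
    Q ^ n * (a * f n + b * h n + a * b * (Q ^ n * f n)) ∎

  h-suc : ∀ n → h (suc n) ≈ Q ^ n * (b * h n + a * b * (Q ^ n * f n) + a * (Q ^ suc n * f n))
  h-suc n = begin
    h (suc n)  ≈⟨ S-suc-zero n 2 ⟩
    -- The least part is 2, 3 or 4; both 3 and 4 are followed by the window starting at 7.
    b * S⟨ n , 0 , 5 ⟩ + (Q * (u * v) * S⟨ n , 0 , 7 ⟩ + Q * a * S⟨ n , 0 , 7 ⟩)
      ≈⟨ +-cong (*-congˡ (S-shift n 0 2))
           (+-cong (*-congˡ (S₇ n)) (*-congˡ (S₇ n))) ⟩
    b * (Q ^ n * h n) + (Q * (u * v) * (Q ^ n * (Q ^ n * f n)) + Q * a * (Q ^ n * (Q ^ n * f n)))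
      ≈⟨ solve 6 (λ u v q p f h → let q² = q :* (q :* con 1); q³ = q :* q² in
           v :* q² :* (p :* h) :+
             (q³ :* (u :* v) :* (p :* (p :* f)) :+ q³ :* (u :* q) :* (p :* (p :* f))) :=
           p :* (v :* q² :* h :+ u :* q :* (v :* q²) :* (p :* f) :+
             u :* q :* (q³ :* p :* f))) refl
           u v q (Q ^ n) (f n) (h n) ⟩
    Q ^ n * (b * h n + a * b * (Q ^ n * f n) + a * (Q ^ suc n * f n)) ∎

  open Product a b f h weight-[] weight-[] f-suc h-suc

  -- The finite identity and q-shifted factorials.

  pochhammer : Carrier → Carrier → ℕ → Carrier
  pochhammer x p n = product {n} λ j → 1# + - (x * p ^ toℕ j)

  pochhammer-suc : ∀ x p n → pochhammer x p (suc n) ≈ pochhammer x p n * (1# + - (x * p ^ n))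
  pochhammer-suc x p n = trans (product-init-last {n} (λ j → factor (toℕ j)))
    (*-cong (product-cong {n} λ i → reflexive (≡.cong factor (Fin.toℕ-inject₁ i)))
              (reflexive (≡.cong factor (Fin.toℕ-fromℕ n))))
    where
    factor : ℕ → Carrier
    factor j = 1# + - (x * p ^ j)

  negative-factor : ∀ x y p → 1# + - (- x * y * p) ≈ 1# + x * y * p
  negative-factor x y p = +-congˡ (begin
    - (- x * y * p)    ≈⟨ -‿cong (*-congʳ (-‿distribˡ-* x y)) ⟨
    - (- (x * y) * p)  ≈⟨ -‿cong (-‿distribˡ-* (x * y) p) ⟨
    - - (x * y * p)    ≈⟨ -‿involutive (x * y * p) ⟩
    x * y * p          ∎)

  pochhammers-product : ∀ N → pochhammer (- u * q) Q N * pochhammer (- v * q ^ 2) Q N ≈ binomialSum N f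
  pochhammers-product zero = sym (*-congˡ weight-[])
  pochhammers-product (suc N) = begin
    pochhammer (- u * q) Q (suc N) * pochhammer (- v * q ^ 2) Q (suc N)
      ≈⟨ *-cong (trans (pochhammer-suc (- u * q) Q N) (*-congˡ (negative-factor u q (Q ^ N))))
           (trans (pochhammer-suc (- v * q ^ 2) Q N) (*-congˡ (negative-factor v (q ^ 2) (Q ^ N)))) ⟩
    x * (1# + a * Q ^ N) * (y * (1# + b * Q ^ N))
      ≈⟨ solve 4 (λ x y s t → x :* s :* (y :* t) := s :* t :* (x :* y)) refl
           x y (1# + a * Q ^ N) (1# + b * Q ^ N) ⟩
    (1# + a * Q ^ N) * (1# + b * Q ^ N) * (x * y)
      ≈⟨ *-congˡ (pochhammers-product N) ⟩
    (1# + a * Q ^ N) * (1# + b * Q ^ N) * binomialSum N f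
      ≈⟨ F-suc N ⟨
    binomialSum (suc N) f ∎
    where
    x = pochhammer (- u * q) Q N
    y = pochhammer (- v * q ^ 2) Q N

  [Q]_ : ℕ → Carrier
  [Q] n = pochhammer Q Q n

  -- One step of `G n l * [Q] n` = `(1 - Q ^ (l + 1)) ⋯ (1 - Q ^ (l + n))`, obtained from absorption
  -- without division.
  G-[Q] : ∀ n l → G (suc n) l * [Q] suc n ≈ G n (suc l) * [Q] n * (1# + - Q ^ suc l)
  G-[Q] n l = begin
    g * [Q] suc n
      ≈⟨ *-congˡ (pochhammer-suc Q Q n) ⟩
    g * ([Q] n * (1# + - Q ^ suc n))
      ≈⟨ solve 3 (λ g x y → g :* (x :* y) := g :* y :* x) refl g ([Q] n) _ ⟩
    g * (1# + - Q ^ suc n) * [Q] n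
      ≈⟨ *-congʳ absorb ⟩
    g′ * (1# + - Q ^ suc l) * [Q] n
      ≈⟨ solve 3 (λ g x y → g :* y :* x := g :* x :* y) refl g′ ([Q] n) _ ⟩
    g′ * [Q] n * (1# + - Q ^ suc l) ∎
    where
    g  = G (suc n) l
    g′ = G n (suc l)
    absorb : g * (1# + - Q ^ suc n) ≈ g′ * (1# + - Q ^ suc l)
    absorb = begin
      g * (1# + - Q ^ suc n)
        ≈⟨ expand g (Q ^ suc n) ⟩
      g + - (Q ^ suc n * g)
        ≈⟨ rearrange (G-absorption n l) ⟩
      g′ + - (Q ^ suc l * g′)
        ≈⟨ expand g′ (Q ^ suc l) ⟨
      g′ * (1# + - Q ^ suc l) ∎
      where
      expand : ∀ x p → x * (1# + - p) ≈ x + - (p * x)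
      expand x p = trans (distribˡ x 1# (- p)) (+-cong (*-identityʳ x)
        (trans (sym (-‿distribʳ-* x p)) (-‿cong (*-comm x p))))
      rearrange : ∀ {w x y z} → w + x ≈ y + z → w + - z ≈ y + - x
      rearrange {w} {x} {y} {z} eq = begin
        w + - z                ≈⟨ +-congˡ {w} (+-identityˡ (- z)) ⟨
        w + (0# + - z)         ≈⟨ +-congˡ {w} (+-congʳ (-‿inverseʳ x)) ⟨
        w + (x + - x + - z)
          ≈⟨ solve 4 (λ w x m n → w :+ (x :+ m :+ n) := w :+ x :+ m :+ n) refl w x (- x) (- z) ⟩
        w + x + - x + - z      ≈⟨ +-congʳ (+-congʳ eq) ⟩
        y + z + - x + - z
          ≈⟨ solve 4 (λ y z m n → y :+ z :+ m :+ n := y :+ m :+ (z :+ n)) refl y z (- x) (- z) ⟩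
        y + - x + (z + - z)    ≈⟨ +-congˡ {y + - x} (-‿inverseʳ z) ⟩
        y + - x + 0#           ≈⟨ +-identityʳ (y + - x) ⟩
        y + - x                ∎

  product-pochhammers : ∀ N →
    product {N} (λ j → (1# + u * q ^ (3 ℕ.* suc (toℕ j) ∸ 2)) *
                       (1# + v * q ^ (3 ℕ.* suc (toℕ j) ∸ 1))) ≈
    pochhammer (- u * q) Q N * pochhammer (- v * q ^ 2) Q N
  product-pochhammers N = trans (product-cong {N} λ j → *-cong
        (trans (factor u 2 (s≤s (s≤s z≤n)) (toℕ j))
          (+-congˡ (-‿cong (*-congʳ (*-congˡ (*-identityʳ q))))))
        (factor v 1 (s≤s z≤n) (toℕ j)))
      (product-distrib-* {N} (λ j → 1# + - (- u * q * Q ^ toℕ j))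
                          (λ j → 1# + - (- v * q ^ 2 * Q ^ toℕ j)))
    where
    exponent : ∀ j i → i ℕ.≤ 3 → 3 ℕ.* suc j ∸ i ≡ (3 ∸ i) ℕ.+ 3 ℕ.* j
    exponent j i i≤3 = ≡.trans (≡.cong (ℕ._∸ i) (ℕ.*-suc 3 j)) (ℕ.+-∸-comm (3 ℕ.* j) i≤3)
    factor : ∀ x i → i ℕ.≤ 3 → ∀ j → 1# + x * q ^ (3 ℕ.* suc j ∸ i) ≈ 1# + - (- x * q ^ (3 ∸ i) * Q ^ j)
    factor x i i≤3 j = trans (+-congˡ (begin
      x * q ^ (3 ℕ.* suc j ∸ i)          ≡⟨ ≡.cong (λ e → x * q ^ e) (exponent j i i≤3) ⟩
      x * q ^ ((3 ∸ i) ℕ.+ 3 ℕ.* j)      ≈⟨ *-congˡ (^-homo-* q (3 ∸ i) (3 ℕ.* j)) ⟩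
      x * (q ^ (3 ∸ i) * q ^ (3 ℕ.* j))  ≈⟨ *-assoc x _ _ ⟨
      x * q ^ (3 ∸ i) * q ^ (3 ℕ.* j)    ≈⟨ *-congˡ (^-assocʳ q 3 j) ⟨
      x * q ^ (3 ∸ i) * Q ^ j            ∎)) (sym (negative-factor x (q ^ (3 ∸ i)) (Q ^ j)))

  total-schurFamily : ∀ N → total (schurFamily N) ≈ binomialSum N f
  total-schurFamily N = trans (go N _) (antidiagonal-cong N λ n l _ → S-binomial n l 1)
    where
    go : ∀ N t → total (antidiagonalList N t) ≈ antidiagonal N λ n l → total (t n l)
    go zero    t = refl
    go (suc N) t = trans (total-++ (t 0 (suc N)) _) (+-congˡ (go N λ n → t (suc n)))

-- Passage to the limit.

module SchurProduct {c ℓ} (K : CommutativeRing c ℓ) (u₀ v₀ : CommutativeRing.Carrier K) where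

  open Generating K u₀ v₀
  open PowerSeries K using (commutativeRing; sumList; pochhammer-inverseʳ)
  open Truncation K
  open FamilySum commutativeRing u v q hiding (weight; pochhammer)
  open QBinomial commutativeRing Q
  open Product a b f h weight-[] weight-[] f-suc h-suc
  private
    module K = CommutativeRing K
    module S where
      open CommutativeRing commutativeRing public
      open RingProperties ring public
  open SemiringExp S.semiring using (^-assocʳ)

  weight-order : ∀ β → weight β ≈[ size β ] 0#
  weight-order β = *-vanishˡ (u ^ count≡ 0 1 β * v ^ count≡ 0 2 β) (X^-order (size β))

  a-order : a ≈[ 1 ] 0#
  a-order = *-vanishˡ u X-order

  b-order : b ≈[ 1 ] 0#
  b-order = ≈[]-weaken (s≤s z≤n) (*-vanishˡ v (X^-order 2))

  Q^-order : ∀ n → Q ^ n ≈[ n ] 0#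
  Q^-order n = ≈[]-weaken (ℕ.m≤m+n n (2 ℕ.* n)) (≈[]-trans (≈⇒≈[] (^-assocʳ q 3 n)) (X^-order (3 ℕ.* n)))

  -- Every term of the two recurrences carries a factor `a` or `b`, and both are divisible by `q`.
  f-order : ∀ n → f n ≈[ n ] 0#
  h-order : ∀ n → h n ≈[ n ] 0#

  private
    sum-order : ∀ {k x y} → x ≈[ k ] 0# → y ≈[ k ] 0# → x + y ≈[ k ] 0#
    sum-order x≈0 y≈0 = ≈[]-trans (+-cong-≈[] x≈0 y≈0) (≈⇒≈[] (S.+-identityˡ 0#))

    ab-term : ∀ n → a * b * (Q ^ n * f n) ≈[ suc n ] 0#
    ab-term n = *-order-0 {1} {f = a * b} (*-vanishˡ a b-order) (*-vanishˡ (Q ^ n) (f-order n))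

  f-order zero    = λ _ ()
  f-order (suc n) = ≈[]-trans (≈⇒≈[] (f-suc n)) (*-vanishˡ (Q ^ n)
    (sum-order (sum-order (*-order-0 {1} {f = a} a-order (f-order n))
                          (*-order-0 {1} {f = b} b-order (h-order n)))
               (ab-term n)))
  h-order zero    = λ _ ()
  h-order (suc n) = ≈[]-trans (≈⇒≈[] (h-suc n)) (*-vanishˡ (Q ^ n)
    (sum-order (sum-order (*-order-0 {1} {f = b} b-order (h-order n)) (ab-term n))
               (*-order-0 {1} {f = a} a-order (*-vanishˡ (Q ^ suc n) (f-order n)))))

  negate-order : ∀ {k x} → x ≈[ k ] 0# → - x ≈[ k ] 0#
  negate-order x≈0 j j<k = K.trans (K.-‿cong (x≈0 j j<k)) (RingProperties.-0#≈0# K.ring)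

  near-1 : ∀ {k x} → x ≈[ k ] 0# → 1# + x ≈[ k ] 1#
  near-1 {x = x} x≈0 = ≈[]-trans (+-cong-≈[] {f = 1#} (λ _ _ → K.refl) x≈0) (≈⇒≈[] (S.+-identityʳ 1#))

  *-near-1 : ∀ {k} x {y} → y ≈[ k ] 1# → x * y ≈[ k ] x
  *-near-1 x y≈1 = ≈[]-trans (*-cong-≈[] {f = x} (λ _ _ → K.refl) y≈1) (≈⇒≈[] (S.*-identityʳ x))

  pochhammer-step : ∀ {x} → x ≈[ 1 ] 0# → ∀ n → pochhammer x Q (suc n) ≈[ suc n ] pochhammer x Q n
  pochhammer-step {x} x≈0 n = ≈[]-trans (≈⇒≈[] (pochhammer-suc x Q n))
    (*-near-1 (pochhammer x Q n) (near-1 (negate-order (*-order-0 {1} {f = x} x≈0 (Q^-order n)))))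

  -- Read off diagonally: when `x` is divisible by `q`, the factors after the first `k` affect only
  -- coefficients above `k`.
  pochhammer∞ : Series → Series
  pochhammer∞ x k = pochhammer x Q k k

  pochhammer-limit : ∀ {x} → x ≈[ 1 ] 0# → ∀ n → pochhammer x Q n ≈[ suc n ] pochhammer∞ x
  pochhammer-limit x≈0 n j (s≤s j≤n) with ℕ.m≤n⇒m<n∨m≡n j≤n
  ... | inj₂ ≡.refl = K.refl
  pochhammer-limit x≈0 (suc n) j _ | inj₁ j<1+n =
    K.trans (pochhammer-step x≈0 n j j<1+n) (pochhammer-limit x≈0 n j j<1+n)

  ⟶-from-≈[] : ∀ {s g} → (∀ n → s n ≈[ suc n ] g) → s ⟶ g
  ⟶-from-≈[] s≈g k = k , λ n k≤n → s≈g n k (s≤s k≤n)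

  -x-order : ∀ x y → x * y ≈[ 1 ] 0# → - x * y ≈[ 1 ] 0#
  -x-order x y xy≈0 = ≈[]-trans (≈⇒≈[] (S.sym (S.-‿distribˡ-* x y))) (negate-order xy≈0)

  U V P : Series
  U = pochhammer∞ (- u * q)
  V = pochhammer∞ (- v * q ^ 2)
  P = U * V

  U-limit : ∀ n → pochhammer (- u * q) Q n ≈[ suc n ] U
  U-limit = pochhammer-limit (-x-order u q a-order)

  V-limit : ∀ n → pochhammer (- v * q ^ 2) Q n ≈[ suc n ] V
  V-limit = pochhammer-limit (-x-order v (q ^ 2) b-order)

  binomialSum-limit : ∀ N → binomialSum N f ≈[ suc N ] P
  binomialSum-limit N = ≈[]-trans (≈⇒≈[] (S.sym (pochhammers-product N)))
    (*-cong-≈[] {f = pochhammer (- u * q) Q N} (U-limit N) (V-limit N))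

  product-limit : (λ N → ∏[ j < N ] ((1# + u * q ^ (3 ℕ.* suc (toℕ j) ∸ 2)) *
                                     (1# + v * q ^ (3 ℕ.* suc (toℕ j) ∸ 1)))) ⟶ P
  product-limit = ⟶-from-≈[] λ N → ≈[]-trans (≈⇒≈[] (product-pochhammers N))
    (*-cong-≈[] {f = pochhammer (- u * q) Q N} (U-limit N) (V-limit N))

  G-near-inverse : ∀ n l → G n l * [Q] n ≈[ suc l ] 1#
  G-near-inverse zero    l = ≈⇒≈[] (S.*-identityˡ 1#)
  G-near-inverse (suc n) l = ≈[]-trans (≈⇒≈[] (G-[Q] n l))
    (≈[]-trans (*-near-1 (G n (suc l) * [Q] n) (near-1 (negate-order (Q^-order (suc l)))))
      (≈[]-weaken (ℕ.n≤1+n (suc l)) (G-near-inverse n (suc l))))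

  G-limit : ∀ n l → G n l ≈[ suc l ] [Q] n ⁻¹
  -- `G n l` is multiplied by `[Q] n * [Q] n ⁻¹`; the argument 2 encodes that `Q` is `q ^ suc 2`.
  G-limit n l = ≈[]-trans (≈[]-sym (*-near-1 (G n l) (≈⇒≈[] (pochhammer-inverseʳ 2 Q n))))
    (≈[]-trans (≈⇒≈[] (S.sym (S.*-assoc (G n l) ([Q] n) ([Q] n ⁻¹))))
    (≈[]-trans (*-cong-≈[] {f = G n l * [Q] n} (G-near-inverse n l) (λ _ _ → K.refl))
      (≈⇒≈[] (S.*-identityˡ ([Q] n ⁻¹)))))

  antidiagonal-cong-≈[] : ∀ {k} N {s t} → (∀ n l → n ℕ.+ l ≡ N → s n l ≈[ k ] t n l) →
                          antidiagonal N s ≈[ k ] antidiagonal N t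
  antidiagonal-cong-≈[] zero    s≈t = s≈t 0 0 ≡.refl
  antidiagonal-cong-≈[] (suc N) s≈t = +-cong-≈[] (s≈t 0 (suc N) ≡.refl)
    (antidiagonal-cong-≈[] N λ n l eq → s≈t (suc n) l (≡.cong suc eq))

  -- `family n 0 1` is itself a duplicate-free listing of the same set, and its recursive form is
  -- the one that yields recurrences.
  enumeration-sum : ∀ n (e : Enumeration (𝓑OfLength n)) → ∑⟨ e ⟩ weight ≈ f n
  enumeration-sum n (xs , uxs , spec) k = sumList-⊆ weight k (family-unique n 0 1) uxs
    (λ {β} β∈ → Equivalence.from (spec β) (∈-family⇒𝓑OfLength n β β∈))
    (λ {β} β∈ → inj₁ (𝓑OfLength⇒∈-family (Equivalence.to (spec β) β∈)))

  b𝓢≈f : ∀ n → b𝓢 n ≈ f n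
  b𝓢≈f n = enumeration-sum n (𝓑-enumeration n)

  series-limit : (λ N → ∑[ n < N ] (b𝓢 (toℕ n) * pochhammer Q Q (toℕ n) ⁻¹)) ⟶ P
  -- The sum with `suc N` terms, n = 0 to N, is the one comparable with `binomialSum N f`, whence
  -- the shift by one in the witness.
  series-limit k = suc k , λ { (suc N) (s≤s k≤N) → K.sym (K.trans
    (K.sym (binomialSum-limit N k (s≤s k≤N)))
    (K.trans (antidiagonal-cong-≈[] N terms k (s≤s k≤N)) (antidiagonal-const N _ k))) }
    where
    -- The error of `G n l` starts at order `l + 1` and `f n` has order `n`, so together they reach
    -- order N + 1.
    terms : ∀ {N} n l → n ℕ.+ l ≡ N → G n l * f n ≈[ suc N ] b𝓢 n * [Q] n ⁻¹
    terms n l ≡.refl = ≈[]-trans (≈⇒≈[] (S.*-comm (G n l) (f n)))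
      (≈[]-trans (≡.subst (λ m → f n * G n l ≈[ m ] f n * [Q] n ⁻¹) (ℕ.+-suc n l)
                   (*-order {f = f n} (f-order n) (G-limit n l)))
                 (≈⇒≈[] (S.*-congʳ (S.sym (b𝓢≈f n)))))

  schur-sum : HasSum Schur weight P
  schur-sum k = schurFamily N , schurFamily-Schur N , λ ys uys schur xs⊆ys → K.trans
    (sumList-⊆ weight k (schurFamily-unique N) uys xs⊆ys (λ y∈ → small-or-zero (All.lookup schur y∈)))
    (K.trans (total-schurFamily N k) (binomialSum-limit N k (s≤s (ℕ.m≤m+n k k))))
    where
    -- Twice `k`, so that `schurFamily-complete` covers all partitions of size at most `k`; larger
    -- ones have no coefficient at `k`.
    N = k ℕ.+ k
    small-or-zero : ∀ {π} → Schur π → π ∈ schurFamily N ⊎ weight π k K.≈ K.0#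
    small-or-zero {π} s with size π ℕ.≤? k
    ... | yes le = inj₁ (schurFamily-complete s (ℕ.+-mono-≤ le le))
    ... | no  nl = inj₂ (weight-order π k (ℕ.≰⇒> nl))

  -- Specialisation to coefficients in ℤ[u,v].

  -- The symbols of the theorem are kept variable so that an instance is compared with
  -- another one symbol by symbol: the type checker cannot cope with unfolding whole
  -- series over a concrete polynomial ring.
  data Vocabulary : ((ℕ → Series) → Series → Set ℓ) → (Series → Series → Set ℓ) →
    ((List ℕ → Series) → Series → Set ℓ) →
    Series → (Series → Series → Series) → (Series → Series → Series) → (Series → Series) →
    (Series → ℕ → Series) → (Series → Series) → (Series → Series → ℕ → Series) →
    (∀ n → (Fin n → Series) → Series) → (∀ n → (Fin n → Series) → Series) →
    Series → Series → Series → (List ℕ → Series) → (ℕ → Series) → Set where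
    canonical : Vocabulary _⟶_ _≈_ (HasSum Schur) 1# _+_ _*_ (-_) _^_ _⁻¹ pochhammer
      product-syntax sum-syntax u v q weight b𝓢

  theorem : ∀ {_⟶′_ _≈′_ HasSum′ 1#′ _+′_ _*′_ -′_ _^′_ _⁻¹′ pochhammer′ ∏′ ∑′ u′ v′ q′ weight′ b𝓢′} →
    Vocabulary _⟶′_ _≈′_ HasSum′ 1#′ _+′_ _*′_ -′_ _^′_ _⁻¹′ pochhammer′ ∏′ ∑′ u′ v′ q′ weight′ b𝓢′ →
    ∃[ U ] ∃[ V ] ∃[ P ]
      (pochhammer′ ((-′ u′) *′ q′) (q′ ^′ 3) ⟶′ U) ×
      (pochhammer′ ((-′ v′) *′ (q′ ^′ 2)) (q′ ^′ 3) ⟶′ V) ×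
      ((λ N → ∏′ N λ j → (1#′ +′ (u′ *′ (q′ ^′ (3 ℕ.* suc (toℕ j) ∸ 2)))) *′
                         (1#′ +′ (v′ *′ (q′ ^′ (3 ℕ.* suc (toℕ j) ∸ 1))))) ⟶′ P) ×
      ((λ N → ∑′ N λ n → b𝓢′ (toℕ n) *′ (pochhammer′ (q′ ^′ 3) (q′ ^′ 3) (toℕ n) ⁻¹′)) ⟶′ (U *′ V)) ×
      ((U *′ V) ≈′ P) ×
      HasSum′ weight′ P
  theorem canonical =
    U , V , P , ⟶-from-≈[] U-limit , ⟶-from-≈[] V-limit ,
    product-limit , series-limit , S.refl , schur-sum

open import Defs

-- Passing ℤ[u,v] to Vocabulary directly instead of through Z defeats the comparison:
-- the two coefficient rings are then equal only after unfolding.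
private
  module Z = SchurProduct ℤ[u,v].commutativeRing (ℤ[u,v].const ℤ[u].X) ℤ[u,v].X

vocabulary : Z.Vocabulary
  _⟶_ _≈_ (HasSum Schur) 1# _+_ _*_ (-_) _^_ _⁻¹ pochhammer product-syntax sum-syntax u v q weight b𝓢
vocabulary = Z.canonical

theorem11 : ∃[ U ] ∃[ V ] ∃[ P ]
    (pochhammer (- u * q) (q ^ 3) ⟶ U) ×
    (pochhammer (- v * q ^ 2) (q ^ 3) ⟶ V) ×
    ((λ N → ∏[ j < N ] ((1# + u * q ^ (3 ℕ.* suc (toℕ j) ∸ 2)) * (1# + v * q ^ (3 ℕ.* suc (toℕ j) ∸ 1)))) ⟶ P) ×
    ((λ N → ∑[ n < N ] (b𝓢 (toℕ n) * pochhammer (q ^ 3) (q ^ 3) (toℕ n) ⁻¹)) ⟶ U * V) ×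
    (U * V ≈ P) ×
    HasSum Schur weight P
theorem11 = Z.theorem vocabulary
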